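{- There is an absolute constant $c>0$ such that for every improving multi-armed bandits instance with $k\ge 2$ arms and horizon $T>4k$, the following two-phase algorithm (which knows $T$ and $k$ but not the final value of the best arm) has expected total reward at least $c\cdot\dfrac{OPT_T}{\sqrt{k}\,\log k}$: in the first $T/2$ steps run the procedure Find-$\hat m$ with parameter $T_{\mathrm{pred}}=\frac{T}{2}-k$ to obtain a value $\hat m$; in the remaining $T/2$ steps run Random Round Robin with threshold parameter $\hat m$ and time parameter $\tau=T_{\mathrm{pred}}=\frac T2-k$.
   Context: An instance of the improving multi-armed bandits problem consists of $k$ arms; arm $i$ has a reward function $f_i:\{0,1,2,\dots\}\to\mathbb{R}_{\ge 0}$ that is nondecreasing, satisfies $f_i(0)=0$, and has diminishing returns: $f_i(t+1)-f_i(t)\le f_i(t)-f_i(t-1)$ for all $t\ge 1$. Pulling arm $i$ for the $t$-th time yields reward $f_i(t)$. $OPT_T=\max_i\sum_{t=1}^T f_i(t)$. Quantities such as $T/2$ and $T/(2k)$ are treated as integers. Find-$\hat m$ with parameter $T_{\mathrm{pred}}$: pull each arm $i$ exactly $T/(2k)$ times and set $\hat m_L^{(i)}=f_i\!\left(\tfrac{T}{2k}\right)$ and $\hat m_U^{(i)}=f_i\!\left(\tfrac{T}{2k}\right)+\left(f_i\!\left(\tfrac{T}{2k}\right)-f_i\!\left(\tfrac{T}{2k}-1\right)\right)\left(T-\tfrac{T}{2k}\right)$. Let $L=\tfrac12\max_i\hat m_L^{(i)}$ and $U=\max_i\hat m_U^{(i)}$. Draw $j$ uniformly at random from the set of integers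 $\{ -\lceil\log_2(T/T_{\mathrm{pred}})\rceil,\dots,0,1,2,\dots,\lceil\log_2(U/L)\rceil\}$ and return $\hat m=L\cdot 2^j$ (if $L=0$ all rewards are $0$ and the claim is trivial). Random Round Robin with parameters $m,\tau$: repeatedly choose an arm $i$ uniformly at random among the arms not chosen so far in this phase, set a counter $t_i=0$, and keep pulling it (each pull increases $t_i$ by one) as long as the current observed reward of arm $i$ is at least $m\,t_i/\tau$; when this test first fails, abandon arm $i$ and choose a new arm; stop when the allotted time has run out (or no arm remains). Counters $t_i$ start from $0$ in the second phase; the pulls from the first phase only increase the rewards subsequently obtained from an arm. The total reward is the sum of all rewards; expectation is over the algorithm's randomness. -}

module Defs where

open import Algebra.Bundles using (CommutativeRing; Semiring)
import Algebra.Definitions.RawMonoid as RawMonoidDefs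
import Algebra.Definitions.RawSemiring as RawSemiringDefs
open import Data.Bool.Base using (if_then_else_)
open import Data.Fin.Base using (Fin; zero; suc; toℕ)
open import Data.Integer.Base as ℤ using (ℤ; +_; -[1+_])
import Data.List.Base as List
import Data.List.Extrema as Extrema
open import Data.Nat.Base as ℕ using (ℕ; zero; suc; NonZero)
import Data.Nat.DivMod as ℕ using (_/_)
import Data.Nat.Properties as ℕ
open import Data.Product.Base using (∃; ∃₂; _×_; _,_; map₁)
open import Data.Vec.Base using (Vec; []; _∷_; lookup; removeAt; allFin)
open import Function.Base using (_∘_)
open import Function.Bundles using (_⇔_)
open import Level using (0ℓ)
open import Relation.Binary.Bundles using (DecTotalOrder)
open import Relation.Binary.Core using (Rel)
import Relation.Binary.Construct.NonStrictToStrict as NonStrictToStrict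
open import Relation.Binary.Structures using (IsDecTotalOrder)
open import Relation.Nullary using (¬_; does)

module Numerals (R : CommutativeRing 0ℓ 0ℓ) where
  open CommutativeRing R

  open RawMonoidDefs +-rawMonoid public
    using (sum)
    renaming (_×_ to _×ᴿ_)

  open RawSemiringDefs (Semiring.rawSemiring semiring) public
    using (_^_)

  fromℕ : ℕ → Carrier
  fromℕ n = n ×ᴿ 1#

  fromℤ : ℤ → Carrier
  fromℤ (+ n)    = fromℕ n
  fromℤ -[1+ n ] = - fromℕ (suc n)

-- The classical real numbers, axiomatised as a complete ordered field. As in
-- classical mathematics the order is decidable and every nonempty bounded
-- predicate has a supremum. Division and suprema are total functions whose
-- values are unspecified outside their usual domains (x / 0, and suprema of
-- empty or unbounded predicates).

record Reals : Set₁ where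
  field
    commutativeRing : CommutativeRing 0ℓ 0ℓ

  open CommutativeRing commutativeRing public
    using (_≈_; _≉_; _+_; _*_; -_; _-_; 0#; 1#)
    renaming (Carrier to ℝ)

  open Numerals commutativeRing public

  infix  4 _≤_
  infix  8 _⁻¹
  infixl 7 _/_

  field
    0≉1             : 0# ≉ 1#
    _⁻¹             : ℝ → ℝ
    ⁻¹-cong         : ∀ {x y} → x ≈ y → x ⁻¹ ≈ y ⁻¹
    *-inverseʳ      : ∀ {x} → x ≉ 0# → x * x ⁻¹ ≈ 1#

    _≤_             : Rel ℝ 0ℓ
    isDecTotalOrder : IsDecTotalOrder _≈_ _≤_
    +-monoˡ-≤       : ∀ z {x y} → x ≤ y → x + z ≤ y + z
    *-nonneg        : ∀ {x y} → 0# ≤ x → 0# ≤ y → 0# ≤ x * y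

  UpperBound : (ℝ → Set) → ℝ → Set
  UpperBound P u = ∀ x → P x → x ≤ u

  field
    sup       : (ℝ → Set) → ℝ
    sup-upper : ∀ P → ∃ P → ∃ (UpperBound P) → UpperBound P (sup P)
    sup-least : ∀ P → ∃ P → ∃ (UpperBound P) → ∀ u → UpperBound P u → sup P ≤ u

    -- Determined by the rest, but its existence is derivable from completeness
    -- only with classical logic beyond decidability of the order.
    ⌈_⌉       : ℝ → ℤ
    ⌈⌉-galois : ∀ x z → (⌈ x ⌉ ℤ.≤ z) ⇔ (x ≤ fromℤ z)

  decTotalOrder : DecTotalOrder 0ℓ 0ℓ 0ℓ
  decTotalOrder = record { isDecTotalOrder = isDecTotalOrder }

  open DecTotalOrder decTotalOrder public using (totalOrder; _≤?_)

  open NonStrictToStrict _≈_ _≤_ public using (_<_)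

  _/_ : ℝ → ℝ → ℝ
  x / y = x * y ⁻¹

  2# : ℝ
  2# = fromℕ 2

  2^_ : ℤ → ℝ
  2^ (+ n)    = 2# ^ n
  2^ -[1+ n ] = (2# ^ suc n) ⁻¹

  √ : ℝ → ℝ
  √ x = sup λ r → r * r ≤ x

  -- For x > 0, log₂ x is the supremum of the rationals p/q (q ≥ 1) with
  -- 2^(p/q) ≤ x, that is, with 2^p ≤ x^q.
  log₂ : ℝ → ℝ
  log₂ x = sup λ r → ∃₂ λ p q →
    (r ≈ fromℤ p / fromℕ (suc q)) × (2^ p ≤ x ^ suc q)

  max : ∀ {n} .{{_ : NonZero n}} → (Fin n → ℝ) → ℝ
  max {suc n} g = Extrema.max totalOrder (g zero) (List.tabulate (g ∘ suc))

-- Computations with finitely many uniform random choices: `choose g` draws i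
-- uniformly from Fin (suc n), independently of earlier draws, and continues
-- with g i.

data Rand (A : Set) : Set where
  return : A → Rand A
  choose : ∀ {n} → (Fin (suc n) → Rand A) → Rand A

infixl 1 _>>=_

_>>=_ : ∀ {A B : Set} → Rand A → (A → Rand B) → Rand B
return a >>= h = h a
choose g >>= h = choose λ i → g i >>= h

-- A uniformly random integer in {lo, …, hi}, for lo ≤ hi.
uniform[_,_] : ℤ → ℤ → Rand ℤ
uniform[ lo , hi ] = choose {n = ℤ.∣ hi ℤ.- lo ∣} λ i → return (lo ℤ.+ + toℕ i)

module Bandits (ℛ : Reals) where
  open Reals ℛ

  𝔼 : Rand ℝ → ℝ
  𝔼 (return x)     = x
  𝔼 (choose {n} g) = sum (λ i → 𝔼 (g i)) / fromℕ (suc n)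

  record Instance (k : ℕ) : Set where
    field
      f           : Fin k → ℕ → ℝ
      nonneg      : ∀ i t → 0# ≤ f i t
      monotone    : ∀ i {s t} → s ℕ.≤ t → f i s ≤ f i t
      zero-start  : ∀ i → f i 0 ≈ 0#
      diminishing : ∀ i t →
        f i (suc (suc t)) - f i (suc t) ≤ f i (suc t) - f i t

  module _ {k : ℕ} .{{_ : NonZero k}} (I : Instance k) where
    open Instance I

    cumulative : Fin k → ℕ → ℝ
    cumulative i n = sum {n} λ t → f i (suc (toℕ t))

    OPT : ℕ → ℝ
    OPT T = max λ i → cumulative i T

    -- The number T/(2k) of pulls of each arm in the first phase.
    initialPulls : ℕ → ℕ
    initialPulls T = (T ℕ./ (2 ℕ.* k)) {{ℕ.m*n≢0 2 k}}

    -- If L = 0 then the upper end of the range of j is unspecified, but the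
    -- returned value is L · 2^j = 0 for every j.
    find-m̂ : (T Tpred : ℕ) → Rand ℝ
    find-m̂ T Tpred =
      uniform[ ℤ.- ⌈ log₂ (fromℕ T / fromℕ Tpred) ⌉ , ⌈ log₂ (U / L) ⌉ ] >>= λ j →
      return (L * 2^ j)
      where
      N : ℕ
      N = initialPulls T

      m̂L m̂U : Fin k → ℝ
      m̂L i = f i N
      m̂U i = f i N + (f i N - f i (N ℕ.∸ 1)) * fromℕ (T ℕ.∸ N)

      L U : ℝ
      L = max m̂L / 2#
      U = max m̂U

    -- Random Round Robin with parameters m and τ, started after every arm has
    -- already been pulled N times.
    module RoundRobin (m : ℝ) (τ N : ℕ) where

      -- Keep pulling arm i, already pulled t times in this phase, with s steps
      -- left: the reward collected and the steps left over. The test precedes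
      -- each pull and uses the most recently observed reward f i (N + t).
      pull : (i : Fin k) (t s : ℕ) → ℝ × ℕ
      pull i t zero    = 0# , zero
      pull i t (suc s) =
        if does (m * fromℕ t / fromℕ τ ≤? f i (N ℕ.+ t))
        then map₁ (λ r → f i (N ℕ.+ suc t) + r) (pull i (suc t) s)
        else (0# , suc s)

      -- The total reward of the phase, given the arms not yet chosen and the
      -- number of steps left.
      run : ∀ {n} → Vec (Fin k) n → ℕ → Rand ℝ
      run         _    zero    = return 0#
      run {zero}  _    (suc s) = return 0#
      run {suc n} arms (suc s) = choose λ p →
        let (r , s′) = pull (lookup arms p) 0 (suc s) in
        run (removeAt arms p) s′ >>= λ r′ →
        return (r + r′)

    randomRoundRobin : (m : ℝ) (τ N steps : ℕ) → Rand ℝ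
    randomRoundRobin m τ N steps = RoundRobin.run m τ N (allFin k) steps

    -- The total reward of the two-phase algorithm.
    algorithm : (T : ℕ) → Rand ℝ
    algorithm T =
      find-m̂ T Tpred >>= λ m̂ →
      randomRoundRobin m̂ Tpred N (T ℕ./ 2) >>= λ r →
      return (sum (λ i → cumulative i N) + r)
      where
      N Tpred : ℕ
      N     = initialPulls T
      Tpred = T ℕ./ 2 ℕ.∸ k

module Submission where

-- Let N = T/(2k), S = T/2 = kN and τ = kN - k, and let the best arm maximise
-- μ = f(τ). Concavity gives OPT ≤ 3 T μ, and 2 L ≤ μ ≤ U ≤ 4 k L, so one of the
-- O(log k) values L·2^j drawn in the first phase lies in [μ/2, μ].
--
-- With such a threshold m the best arm passes the test up to counter τ, and a
-- pulls of any arm yield about m a²/(2τ). Consider the first q ≈ √k arms drawn.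
-- If they use up half of the time, Cauchy-Schwarz makes their reward at least of
-- order m S / q. Otherwise the best arm, which is among them with probability
-- q / k ≈ 1 / q, still has half of the time left and yields order m S. Replacing
-- a² by a tangent makes the first bound additive over the arms, so that both
-- cases are handled by one induction on the number of arms left.

open import Defs
open import Algebra.Bundles using (CommutativeRing)
import Algebra.Properties.AbelianGroup as AbelianGroupProperties
import Algebra.Properties.CommutativeMonoid.Sum as CommutativeMonoidSum
import Algebra.Properties.Ring as RingProperties
import Algebra.Properties.Semiring.Exp as SemiringExp
import Algebra.Properties.Semiring.Mult as SemiringMult
import Algebra.Solver.Ring as RingSolver
open import Algebra.Solver.Ring.AlmostCommutativeRing
  using (fromCommutativeRing; _-Raw-AlmostCommutative⟶_)
open import Data.Fin.Base using (Fin; zero; suc; fromℕ<; punchIn; punchOut; toℕ)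
import Data.Fin.Properties as Fin
open import Data.Integer.Base as ℤ using (ℤ; +_; -[1+_])
import Data.Integer.Properties as ℤ
import Data.List.Base as List
import Data.List.Extrema as Extrema
import Data.List.Relation.Unary.All.Properties as All
open import Data.Maybe.Base using (Maybe; just; nothing)
open import Data.Nat.Base as ℕ using (ℕ; zero; suc; NonZero)
open import Data.Nat.Divisibility using (_∣_; divides)
import Data.Nat.DivMod as ℕ
import Data.Nat.Properties as ℕ
open import Data.Product.Base using (∃; ∃₂; _×_; _,_; proj₁; proj₂)
open import Data.Sum.Base using (inj₁; inj₂; [_,_]′)
open import Data.Vec.Base using (Vec; lookup; removeAt; allFin)
open import Data.Vec.Properties using (lookup-allFin; removeAt-punchOut)
open import Function.Base using (_∘_)
open import Function.Bundles using (Equivalence)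
open import Level using (0ℓ)
open import Relation.Binary.Bundles using (DecTotalOrder)
import Relation.Binary.PropositionalEquality as ≡
open ≡ using (_≡_; _≢_)
import Relation.Binary.Reasoning.Setoid as SetoidReasoning
open import Relation.Nullary using (¬_; contradiction; no; yes)

-- The canonical map from the integers to a ring, and a ring solver with integer literals.

module IntegerCoefficients (R : CommutativeRing 0ℓ 0ℓ) where
  open CommutativeRing R
  open Numerals R
  open RingProperties ring
  open AbelianGroupProperties +-abelianGroup using (⁻¹-∙-comm)
  open SemiringMult semiring using (×-homo-+; ×1-homo-*)
  open SetoidReasoning setoid

  fromℕ-+ : ∀ m n → fromℕ (m ℕ.+ n) ≈ fromℕ m + fromℕ n
  fromℕ-+ = ×-homo-+ 1#

  fromℕ-* : ∀ m n → fromℕ (m ℕ.* n) ≈ fromℕ m * fromℕ n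
  fromℕ-* = ×1-homo-*

  fromℤ-⊖ : ∀ m n → fromℤ (m ℤ.⊖ n) ≈ fromℕ m - fromℕ n
  fromℤ-⊖ m       zero    = sym (trans (+-congˡ -0#≈0#) (+-identityʳ _))
  fromℤ-⊖ zero    (suc n) = sym (+-identityˡ _)
  fromℤ-⊖ (suc m) (suc n) = begin
    fromℤ (suc m ℤ.⊖ suc n)                ≡⟨ ≡.cong fromℤ (ℤ.[1+m]⊖[1+n]≡m⊖n m n) ⟩
    fromℤ (m ℤ.⊖ n)                        ≈⟨ fromℤ-⊖ m n ⟩
    a - b                                  ≈⟨ +-congʳ (+-identityˡ a) ⟨
    0# + a - b                             ≈⟨ +-congʳ (+-congʳ (-‿inverseʳ 1#)) ⟨
    1# - 1# + a - b                        ≈⟨ +-congʳ (+-assoc 1# (- 1#) a) ⟩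
    1# + (- 1# + a) - b                    ≈⟨ +-congʳ (+-congˡ (+-comm (- 1#) a)) ⟩
    1# + (a - 1#) - b                      ≈⟨ +-congʳ (+-assoc 1# a (- 1#)) ⟨
    1# + a - 1# - b                        ≈⟨ +-assoc (1# + a) (- 1#) (- b) ⟩
    1# + a + (- 1# - b)                    ≈⟨ +-congˡ (⁻¹-∙-comm 1# b) ⟩
    1# + a - (1# + b)                      ∎
    where
    a = fromℕ m
    b = fromℕ n

  fromℤ-- : ∀ i → fromℤ (ℤ.- i) ≈ - fromℤ i
  fromℤ-- (+ zero)   = sym -0#≈0#
  fromℤ-- (+ suc n)  = refl
  fromℤ-- -[1+ n ]   = sym (-‿involutive _)

  fromℤ-+ : ∀ i j → fromℤ (i ℤ.+ j) ≈ fromℤ i + fromℤ j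
  fromℤ-+ (+ m)    (+ n)    = fromℕ-+ m n
  fromℤ-+ (+ m)    -[1+ n ] = fromℤ-⊖ m (suc n)
  fromℤ-+ -[1+ m ] (+ n)    = trans (fromℤ-⊖ n (suc m)) (+-comm _ _)
  fromℤ-+ -[1+ m ] -[1+ n ] = begin
    - fromℕ (suc (suc (m ℕ.+ n)))        ≡⟨ ≡.cong (λ l → - fromℕ l) (ℕ.+-suc (suc m) n) ⟨
    - fromℕ (suc m ℕ.+ suc n)            ≈⟨ -‿cong (fromℕ-+ (suc m) (suc n)) ⟩
    - (fromℕ (suc m) + fromℕ (suc n))    ≈⟨ ⁻¹-∙-comm _ _ ⟨
    - fromℕ (suc m) - fromℕ (suc n)      ∎

  fromℤ-+* : ∀ m j → fromℤ (+ m ℤ.* j) ≈ fromℕ m * fromℤ j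
  fromℤ-+* m (+ n) = trans (reflexive (≡.cong fromℤ (≡.sym (ℤ.pos-* m n)))) (fromℕ-* m n)
  fromℤ-+* m -[1+ n ] = begin
    fromℤ (+ m ℤ.* -[1+ n ])           ≡⟨ ≡.cong fromℤ (ℤ.neg-distribʳ-* (+ m) (+ suc n)) ⟨
    fromℤ (ℤ.- (+ m ℤ.* + suc n))      ≈⟨ fromℤ-- (+ m ℤ.* + suc n) ⟩
    - fromℤ (+ m ℤ.* + suc n)          ≈⟨ -‿cong (fromℤ-+* m (+ suc n)) ⟩
    - (fromℕ m * fromℕ (suc n))        ≈⟨ -‿distribʳ-* _ _ ⟩
    fromℕ m * - fromℕ (suc n)          ∎

  fromℤ-* : ∀ i j → fromℤ (i ℤ.* j) ≈ fromℤ i * fromℤ j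
  fromℤ-* (+ m) j = fromℤ-+* m j
  fromℤ-* -[1+ m ] j = begin
    fromℤ (-[1+ m ] ℤ.* j)         ≡⟨ ≡.cong fromℤ (ℤ.neg-distribˡ-* (+ suc m) j) ⟨
    fromℤ (ℤ.- (+ suc m ℤ.* j))    ≈⟨ fromℤ-- (+ suc m ℤ.* j) ⟩
    - fromℤ (+ suc m ℤ.* j)        ≈⟨ -‿cong (fromℤ-+* (suc m) j) ⟩
    - (fromℕ (suc m) * fromℤ j)    ≈⟨ -‿distribˡ-* _ _ ⟩
    - fromℕ (suc m) * fromℤ j      ∎

  -- Reading 1 as 1#, the solver sees the definitional unfolding of fromℕ (suc n)
  -- as 1# + fromℕ n; other literals n are read as fromℕ n.
  literal : ℤ → Carrier
  literal (+ 1) = 1#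
  literal i     = fromℤ i

  literal≈fromℤ : ∀ i → literal i ≈ fromℤ i
  literal≈fromℤ (+ 0)           = refl
  literal≈fromℤ (+ 1)           = sym (+-identityʳ 1#)
  literal≈fromℤ (+ suc (suc n)) = refl
  literal≈fromℤ -[1+ n ]        = refl

  literal-homomorphism :
    ℤ.+-*-rawRing -Raw-AlmostCommutative⟶ fromCommutativeRing R
  literal-homomorphism = record
    { ⟦_⟧    = literal
    ; +-homo = λ i j → trans (trans (literal≈fromℤ (i ℤ.+ j)) (fromℤ-+ i j))
        (sym (+-cong (literal≈fromℤ i) (literal≈fromℤ j)))
    ; *-homo = λ i j → trans (trans (literal≈fromℤ (i ℤ.* j)) (fromℤ-* i j))
        (sym (*-cong (literal≈fromℤ i) (literal≈fromℤ j)))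
    ; -‿homo = λ i → trans (trans (literal≈fromℤ (ℤ.- i)) (fromℤ-- i))
        (sym (-‿cong (literal≈fromℤ i)))
    ; 0-homo = refl
    ; 1-homo = refl
    }

  literal-≟ : ∀ i j → Maybe (literal i ≈ literal j)
  literal-≟ i j with i ℤ.≟ j
  ... | yes i≡j = just (reflexive (≡.cong literal i≡j))
  ... | no _    = nothing

  open RingSolver ℤ.+-*-rawRing (fromCommutativeRing R) literal-homomorphism literal-≟ public
    using (solve; con; _:=_; _:+_; _:*_; _:-_; :-_)

-- Ordered-field arithmetic.

module OrderedField (ℛ : Reals) where
  open Reals ℛ public
  open IntegerCoefficients commutativeRing public
  open CommutativeRing commutativeRing public
    using (refl; sym; trans; reflexive; +-congˡ; +-congʳ; *-cong; *-congˡ; *-congʳ;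
           *-comm; *-assoc; *-identityˡ; *-identityʳ; +-identityˡ; +-identityʳ;
           -‿inverseʳ; zeroˡ; zeroʳ; semiring; +-commutativeMonoid)
  open DecTotalOrder decTotalOrder public
    using (total; antisym)
    renaming (refl to ≤-refl; reflexive to ≤-reflexive; trans to ≤-trans;
              ≤-respˡ-≈ to ≤-respˡ; ≤-respʳ-≈ to ≤-respʳ)
  open CommutativeMonoidSum +-commutativeMonoid using (sum-remove)
  open SemiringExp semiring using (^-assocʳ)

  infixl 6 _⊕_
  infixl 7 _⊗_

  _⊕_ : ∀ {x y} → 0# ≤ x → 0# ≤ y → 0# ≤ x + y
  _⊕_ {x} {y} 0≤x 0≤y = ≤-trans 0≤y (≤-respˡ (+-identityˡ y) (+-monoˡ-≤ y 0≤x))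

  _⊗_ : ∀ {x y} → 0# ≤ x → 0# ≤ y → 0# ≤ x * y
  _⊗_ = *-nonneg

  Δ : ∀ {x y} → x ≤ y → 0# ≤ y - x
  Δ {x} x≤y = ≤-respˡ (-‿inverseʳ x) (+-monoˡ-≤ (- x) x≤y)

  -- Inequalities are proved by exhibiting the difference of their sides as a
  -- nonnegative combination of the hypotheses' differences Δ h.
  ≤-from : ∀ {x y e} → 0# ≤ e → x + e ≈ y → x ≤ y
  ≤-from {x} {y} {e} 0≤e x+e≈y =
    ≤-respʳ (trans (solve 2 (λ e x → e :+ x := x :+ e) refl e x) x+e≈y)
      (≤-respˡ (+-identityˡ x) (+-monoˡ-≤ x 0≤e))

  +-mono-≤ : ∀ {x y z w} → x ≤ y → z ≤ w → x + z ≤ y + w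
  +-mono-≤ {x} {y} {z} {w} x≤y z≤w = ≤-from (Δ x≤y ⊕ Δ z≤w)
    (solve 4 (λ x y z w → x :+ z :+ ((y :- x) :+ (w :- z)) := y :+ w) refl x y z w)

  0≤x² : ∀ x → 0# ≤ x * x
  0≤x² x with total 0# x
  ... | inj₁ 0≤x = 0≤x ⊗ 0≤x
  ... | inj₂ x≤0 = ≤-respʳ
    (solve 1 (λ x → (con (+ 0) :- x) :* (con (+ 0) :- x) := x :* x) refl x)
    (Δ x≤0 ⊗ Δ x≤0)

  0≤1 : 0# ≤ 1#
  0≤1 = ≤-respʳ (*-identityʳ 1#) (0≤x² 1#)

  1≰0 : ¬ (1# ≤ 0#)
  1≰0 1≤0 = 0≉1 (antisym 0≤1 1≤0)

  *-monoˡ-≤ : ∀ {c x y} → 0# ≤ c → x ≤ y → c * x ≤ c * y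
  *-monoˡ-≤ {c} {x} {y} 0≤c x≤y = ≤-from (0≤c ⊗ Δ x≤y)
    (solve 3 (λ c x y → c :* x :+ c :* (y :- x) := c :* y) refl c x y)

  *-mono-≤ : ∀ {x y z w} → 0# ≤ x → 0# ≤ w → x ≤ y → z ≤ w → x * z ≤ y * w
  *-mono-≤ {x} {y} {z} {w} 0≤x 0≤w x≤y z≤w = ≤-from (0≤x ⊗ Δ z≤w ⊕ Δ x≤y ⊗ 0≤w)
    (solve 4 (λ x y z w → x :* z :+ (x :* (w :- z) :+ (y :- x) :* w) := y :* w) refl x y z w)

  0<⇒≉0 : ∀ {x} → 0# < x → x ≉ 0#
  0<⇒≉0 (_ , 0≉x) x≈0 = 0≉x (sym x≈0)

  <-≤-trans : ∀ {x y z} → x < y → y ≤ z → x < z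
  <-≤-trans (x≤y , x≉y) y≤z =
    ≤-trans x≤y y≤z , λ x≈z → x≉y (antisym x≤y (≤-respʳ (sym x≈z) y≤z))

  ≰⇒> : ∀ {x y} → ¬ (x ≤ y) → y < x
  ≰⇒> {x} {y} x≰y with total x y
  ... | inj₁ x≤y = contradiction x≤y x≰y
  ... | inj₂ y≤x = y≤x , λ y≈x → x≰y (≤-reflexive (sym y≈x))

  *-inverse-cancelˡ : ∀ {c} → 0# < c → ∀ x → c * (c ⁻¹ * x) ≈ x
  *-inverse-cancelˡ {c} 0<c x =
    trans (sym (*-assoc c (c ⁻¹) x)) (trans (*-congʳ (*-inverseʳ (0<⇒≉0 0<c))) (*-identityˡ x))

  0≤⁻¹ : ∀ {c} → 0# < c → 0# ≤ c ⁻¹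
  0≤⁻¹ {c} 0<c with total 0# (c ⁻¹)
  ... | inj₁ 0≤c⁻¹ = 0≤c⁻¹
  ... | inj₂ c⁻¹≤0 = contradiction
    (≤-respˡ (*-inverseʳ (0<⇒≉0 0<c)) (≤-respʳ (zeroʳ c) (*-monoˡ-≤ (proj₁ 0<c) c⁻¹≤0))) 1≰0

  *-cancelˡ-≤ : ∀ {c x y} → 0# < c → c * x ≤ c * y → x ≤ y
  *-cancelˡ-≤ {c} {x} {y} 0<c cx≤cy =
    ≤-respˡ (inv x) (≤-respʳ (inv y) (*-monoˡ-≤ (0≤⁻¹ 0<c) cx≤cy))
    where
    inv : ∀ z → c ⁻¹ * (c * z) ≈ z
    inv z = trans (solve 3 (λ d c z → d :* (c :* z) := c :* (d :* z)) refl (c ⁻¹) c z)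
                  (*-inverse-cancelˡ 0<c z)

  *-cancel-/ : ∀ {y} → 0# < y → ∀ x → y * (x / y) ≈ x
  *-cancel-/ {y} 0<y x = trans (*-congˡ (*-comm x (y ⁻¹))) (*-inverse-cancelˡ 0<y x)

  ⁻¹-pos : ∀ {c} → 0# < c → 0# < c ⁻¹
  ⁻¹-pos {c} 0<c = 0≤⁻¹ 0<c , λ 0≈c⁻¹ →
    0≉1 (trans (sym (zeroʳ c)) (trans (*-congˡ 0≈c⁻¹) (*-inverseʳ (0<⇒≉0 0<c))))

  *-pos : ∀ {x y} → 0# < x → 0# < y → 0# < x * y
  *-pos {x} {y} 0<x 0<y = proj₁ 0<x ⊗ proj₁ 0<y , λ 0≈xy →
    proj₂ 0<y (sym (trans (sym (*-inverse-cancelˡ 0<x y))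
      (trans (solve 3 (λ x i y → x :* (i :* y) := i :* (x :* y)) refl x (x ⁻¹) y)
        (trans (*-congˡ (sym 0≈xy)) (zeroʳ (x ⁻¹))))))

  /-mono : ∀ {x y z} → 0# < z → x ≤ y → x / z ≤ y / z
  /-mono {x} {y} {z} 0<z x≤y = ≤-from (Δ x≤y ⊗ 0≤⁻¹ 0<z)
    (solve 3 (λ x y z → x :* z :+ (y :- x) :* z := y :* z) refl x y (z ⁻¹))

  /-≤ : ∀ {a b x y} → 0# < a → 0# < b → x ≤ a * b * y → a ⁻¹ * (x / b) ≤ y
  /-≤ {a} {b} {x} {y} 0<a 0<b x≤aby =
    *-cancelˡ-≤ (*-pos 0<a 0<b) (≤-respˡ (sym eq) x≤aby)
    where
    eq : a * b * (a ⁻¹ * (x / b)) ≈ x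
    eq = trans
      (solve 4 (λ a b c z → a :* b :* (c :* z) := b :* (a :* (c :* z))) refl a b (a ⁻¹) (x / b))
      (trans (*-congˡ (*-inverse-cancelˡ 0<a (x / b))) (*-cancel-/ 0<b x))

  -- Naturals and powers of two in the reals; logarithms, ceilings and square roots.

  fromℕ-1 : fromℕ 1 ≈ 1#
  fromℕ-1 = +-identityʳ 1#

  0≤fromℕ : ∀ n → 0# ≤ fromℕ n
  0≤fromℕ zero    = ≤-refl
  0≤fromℕ (suc n) = 0≤1 ⊕ 0≤fromℕ n

  fromℕ-mono : ∀ {m n} → m ℕ.≤ n → fromℕ m ≤ fromℕ n
  fromℕ-mono {m} {n} m≤n = ≤-from (0≤fromℕ (n ℕ.∸ m))
    (trans (sym (fromℕ-+ m (n ℕ.∸ m))) (reflexive (≡.cong fromℕ (ℕ.m+[n∸m]≡n m≤n))))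

  fromℕ-cancel : ∀ {m n} → fromℕ m ≤ fromℕ n → m ℕ.≤ n
  fromℕ-cancel {m} {n} m≤n with m ℕ.≤? n
  ... | yes m≤n′ = m≤n′
  ... | no m≰n   = contradiction
    (≤-from (Δ (≤-trans (fromℕ-mono (ℕ.≰⇒> m≰n)) m≤n))
      (solve 1 (λ x → con (+ 1) :+ (x :- (con (+ 1) :+ x)) := con (+ 0)) refl (fromℕ n)))
    1≰0

  0<fromℕ-suc : ∀ n → 0# < fromℕ (suc n)
  0<fromℕ-suc n = ≰⇒> λ 1+n≤0 → contradiction (fromℕ-cancel {suc n} {0} 1+n≤0) λ ()

  0<fromℕ : ∀ {n} → 1 ℕ.≤ n → 0# < fromℕ n
  0<fromℕ {suc n} _ = 0<fromℕ-suc n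

  1≤2 : fromℕ 1 ≤ 2#
  1≤2 = fromℕ-mono (ℕ.n≤1+n 1)

  0<2 : 0# < 2#
  0<2 = 0<fromℕ-suc 1

  1≤2^ : ∀ n → 1# ≤ 2# ^ n
  1≤2^ zero    = ≤-refl
  1≤2^ (suc n) = ≤-respˡ (*-identityʳ 1#)
    (*-mono-≤ 0≤1 (≤-trans 0≤1 (1≤2^ n)) (≤-respˡ fromℕ-1 1≤2) (1≤2^ n))

  0≤2^ : ∀ n → 0# ≤ 2# ^ n
  0≤2^ n = ≤-trans 0≤1 (1≤2^ n)

  2^-mono : ∀ {m n} → m ℕ.≤ n → 2# ^ m ≤ 2# ^ n
  2^-mono {n = n} ℕ.z≤n = 1≤2^ n
  2^-mono (ℕ.s≤s m≤n)   = *-monoˡ-≤ (proj₁ 0<2) (2^-mono m≤n)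

  2^-cancel : ∀ {m n} → 2# ^ m ≤ 2# ^ n → m ℕ.≤ n
  2^-cancel {m} {n} 2^m≤2^n with m ℕ.≤? n
  ... | yes m≤n = m≤n
  ... | no m≰n  = contradiction
    (≤-trans (1≤2^ n) (≤-from (Δ (≤-trans (2^-mono (ℕ.≰⇒> m≰n)) 2^m≤2^n))
      (solve 1 (λ x → x :+ (x :- con (+ 2) :* x) := con (+ 0)) refl (2# ^ n))))
    1≰0

  ^-mono : ∀ {x y} n → 0# ≤ x → x ≤ y → x ^ n ≤ y ^ n
  ^-mono zero    0≤x x≤y = ≤-refl
  ^-mono {x} {y} (suc n) 0≤x x≤y =
    *-mono-≤ 0≤x (0≤^ n) x≤y (^-mono n 0≤x x≤y)
    where
    0≤^ : ∀ n → 0# ≤ y ^ n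
    0≤^ zero    = 0≤1
    0≤^ (suc n) = ≤-trans 0≤x x≤y ⊗ 0≤^ n

  fromℕ≤2^ : ∀ n → fromℕ n ≤ 2# ^ n
  fromℕ≤2^ zero    = 0≤1
  fromℕ≤2^ (suc n) = ≤-respʳ (solve 1 (λ x → x :+ x := con (+ 2) :* x) refl (2# ^ n))
    (+-mono-≤ (1≤2^ n) (fromℕ≤2^ n))

  -- `a` lies in the set defining the supremum, as the fraction `a / 1`. A member `p / q` with
  -- `p ≥ 0` has `2^p ≤ x^q ≤ 2^(b q)`, hence `p ≤ b q`.
  log₂-bounds : ∀ {x} a b → 2# ^ a ≤ x → x ≤ 2# ^ b → fromℕ a ≤ log₂ x × log₂ x ≤ fromℕ b
  log₂-bounds {x} a b 2^a≤x x≤2^b =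
    sup-upper P (_ , a∈P) (_ , bound) _ a∈P , sup-least P (_ , a∈P) (_ , bound) _ bound
    where
    P : ℝ → Set
    P r = ∃₂ λ p q → (r ≈ fromℤ p / fromℕ (suc q)) × (2^ p ≤ x ^ suc q)

    a∈P : P (fromℕ a)
    a∈P = + a , 0 ,
      trans (sym (*-cancel-/ (0<fromℕ-suc 0) (fromℕ a)))
        (trans (*-congʳ fromℕ-1) (*-identityˡ _)) ,
      ≤-respʳ (sym (*-identityʳ x)) 2^a≤x

    p≤b*q : ∀ p q → 2^ p ≤ x ^ suc q → fromℤ p ≤ fromℕ (suc q) * fromℕ b
    p≤b*q (+ n) q 2^p≤x^q = ≤-respʳ (trans (fromℕ-* b (suc q)) (*-comm _ _))
      (fromℕ-mono (2^-cancel {n} {b ℕ.* suc q} (≤-trans 2^p≤x^q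
        (≤-respʳ (^-assocʳ 2# b (suc q)) (^-mono (suc q) (≤-trans (0≤2^ a) 2^a≤x) x≤2^b)))))
    p≤b*q -[1+ n ] q _ = ≤-from (0≤fromℕ (suc n) ⊕ 0≤fromℕ (suc q) ⊗ 0≤fromℕ b)
      (solve 2 (λ n y → :- n :+ (n :+ y) := y) refl (fromℕ (suc n)) _)

    bound : UpperBound P (fromℕ b)
    bound r (p , q , r≈p/q , 2^p≤x^q) = *-cancelˡ-≤ (0<fromℕ-suc q)
      (≤-respˡ (sym (trans (*-congˡ r≈p/q) (*-cancel-/ (0<fromℕ-suc q) (fromℤ p))))
        (p≤b*q p q 2^p≤x^q))

  -- The logarithm is at least `a ≥ 0`, so its ceiling cannot be negative. Having it in the form
  -- `+ h` makes the number of values of `j` computable.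
  ⌈log₂⌉-bounds : ∀ {x} a b → 2# ^ a ≤ x → x ≤ 2# ^ b →
    ∃ λ h → ⌈ log₂ x ⌉ ≡ + h × a ℕ.≤ h × h ℕ.≤ b
  ⌈log₂⌉-bounds {x} a b 2^a≤x x≤2^b = natural ⌈ log₂ x ⌉ ≡.refl
    where
    bounds : fromℕ a ≤ log₂ x × log₂ x ≤ fromℕ b
    bounds = log₂-bounds a b 2^a≤x x≤2^b

    natural : ∀ z → ⌈ log₂ x ⌉ ≡ z → ∃ λ h → ⌈ log₂ x ⌉ ≡ + h × a ℕ.≤ h × h ℕ.≤ b
    natural z eq with Equivalence.to (⌈⌉-galois (log₂ x) z) (ℤ.≤-reflexive eq)
                    | Equivalence.from (⌈⌉-galois (log₂ x) (+ b)) (proj₂ bounds)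
    natural (+ h)    eq | log≤z | ⌈⌉≤b =
      h , eq , fromℕ-cancel (≤-trans (proj₁ bounds) log≤z)
        , ℤ.drop‿+≤+ (≡.subst (ℤ._≤ + b) eq ⌈⌉≤b)
    natural -[1+ n ] eq | log≤z | _ = contradiction
      (fromℕ-cancel {suc n} {0} (≤-from (Δ (≤-trans (≤-trans (0≤fromℕ a) (proj₁ bounds)) log≤z))
        (solve 1 (λ x → x :+ (:- x :- con (+ 0)) := con (+ 0)) refl (fromℕ (suc n)))))
      λ ()

  -- As `√` is a supremum, its set must first be bounded. `k` is a bound: either `r ≤ 1 ≤ k`, or
  -- `1 ≤ r` and then `r ≤ r * r ≤ k`.
  fromℕ≤√ : ∀ {q k} → 1 ℕ.≤ k → q ℕ.* q ℕ.≤ k → fromℕ q ≤ √ (fromℕ k)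
  fromℕ≤√ {q} {k} 1≤k q²≤k = sup-upper _ (_ , q∈) (_ , bound) _ q∈
    where
    q∈ : fromℕ q * fromℕ q ≤ fromℕ k
    q∈ = ≤-respˡ (fromℕ-* q q) (fromℕ-mono q²≤k)

    bound : UpperBound (λ r → r * r ≤ fromℕ k) (fromℕ k)
    bound r r²≤k with total r 1#
    ... | inj₁ r≤1 = ≤-trans r≤1 (≤-respˡ fromℕ-1 (fromℕ-mono 1≤k))
    ... | inj₂ 1≤r = ≤-from (Δ r²≤k ⊕ (≤-trans 0≤1 1≤r ⊗ Δ 1≤r))
      (solve 2 (λ r k → r :+ (k :- r :* r :+ r :* (r :- con (+ 1))) := k) refl r (fromℕ k))

  -- Rounds `y` down to a power of two by descending from the known exponent `n`. The exponent found
  -- is a successor, which later makes `ℓ` positive.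
  dyadic : ∀ {y} n → 2# ≤ y → y ≤ 2# ^ n → ∃ λ j → 2# ^ suc j ≤ y × y ≤ 2# ^ suc (suc j)
  dyadic zero 2≤y y≤1 = contradiction
    (2^-cancel {1} {0} (≤-trans (≤-reflexive (*-identityʳ 2#)) (≤-trans 2≤y y≤1))) λ ()
  dyadic (suc zero) 2≤y y≤2 =
    0 , ≤-respˡ (sym (*-identityʳ 2#)) 2≤y , ≤-trans y≤2 (2^-mono (ℕ.n≤1+n 1))
  dyadic {y} (suc (suc n)) 2≤y y≤2^n =
    [ (λ 2^n≤y → n , 2^n≤y , y≤2^n) , dyadic (suc n) 2≤y ]′ (total (2# ^ suc n) y)

  -- Maxima and finite sums.

  ≤-max : ∀ {n} .{{_ : NonZero n}} (g : Fin n → ℝ) i → g i ≤ max g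
  ≤-max {suc n} g zero    = Extrema.⊥≤max totalOrder (g zero) (List.tabulate (g ∘ suc))
  ≤-max {suc n} g (suc i) =
    All.tabulate⁻ (Extrema.xs≤max totalOrder (g zero) (List.tabulate (g ∘ suc))) i

  max-≤ : ∀ {n} .{{_ : NonZero n}} {g : Fin n → ℝ} {u} → (∀ i → g i ≤ u) → max g ≤ u
  max-≤ {suc n} g≤u = Extrema.max≤v⁺ totalOrder (g≤u zero) (All.tabulate⁺ (g≤u ∘ suc))

  argmax : ∀ {n} .{{_ : NonZero n}} (g : Fin n → ℝ) → ∃ λ i → ∀ j → g j ≤ g i
  argmax {suc n} g = Extrema.argmax totalOrder g zero (List.tabulate suc) , λ where
    zero    → Extrema.f[⊥]≤f[argmax] totalOrder {f = g} zero (List.tabulate suc)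
    (suc j) → All.tabulate⁻ (Extrema.f[xs]≤f[argmax] totalOrder {f = g} zero (List.tabulate suc)) j

  0≤sum : ∀ {n} {g : Fin n → ℝ} → (∀ i → 0# ≤ g i) → 0# ≤ sum g
  0≤sum {zero}  0≤g = ≤-refl
  0≤sum {suc n} 0≤g = 0≤g zero ⊕ 0≤sum (0≤g ∘ suc)

  sum-≤ : ∀ {n} {g : Fin n → ℝ} {u} → (∀ i → g i ≤ u) → sum g ≤ fromℕ n * u
  sum-≤ {zero}  {u = u} g≤u = ≤-reflexive (sym (zeroˡ u))
  sum-≤ {suc n} {u = u} g≤u = ≤-respʳ
    (solve 2 (λ n u → u :+ n :* u := (con (+ 1) :+ n) :* u) refl (fromℕ n) u)
    (+-mono-≤ (g≤u zero) (sum-≤ (g≤u ∘ suc)))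

  ≤-sum : ∀ {n} {g : Fin n → ℝ} {u} → (∀ i → u ≤ g i) → fromℕ n * u ≤ sum g
  ≤-sum {zero}  {u = u} u≤g = ≤-reflexive (zeroˡ u)
  ≤-sum {suc n} {u = u} u≤g = ≤-respˡ
    (solve 2 (λ n u → u :+ n :* u := (con (+ 1) :+ n) :* u) refl (fromℕ n) u)
    (+-mono-≤ (u≤g zero) (≤-sum (u≤g ∘ suc)))

  ≤-sum-except : ∀ {n} {g : Fin (suc n) → ℝ} {b u} p → b ≤ g p → (∀ i → i ≢ p → u ≤ g i) →
    b + fromℕ n * u ≤ sum g
  ≤-sum-except {g = g} p b≤gp u≤g = ≤-respʳ (sym (sum-remove {i = p} g))
    (+-mono-≤ b≤gp (≤-sum λ i → u≤g (punchIn p i) (Fin.punchInᵢ≢i p i)))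

-- Integer square roots.

isqrt : ∀ k → ∃ λ q → q ℕ.* q ℕ.≤ k × k ℕ.< suc q ℕ.* suc q
isqrt zero = 0 , ℕ.z≤n , ℕ.s≤s ℕ.z≤n
isqrt (suc k) with isqrt k
... | q , q²≤k , k<[1+q]² with suc q ℕ.* suc q ℕ.≤? suc k
...   | yes [1+q]²≤1+k = suc q , [1+q]²≤1+k ,
  ℕ.≤-<-trans k<[1+q]² (ℕ.*-mono-< (ℕ.n<1+n (suc q)) (ℕ.n<1+n (suc q)))
...   | no [1+q]²≰1+k  = q , ℕ.m≤n⇒m≤1+n q²≤k , ℕ.≰⇒> [1+q]²≰1+k

-- `q` is the integer square root of `k`, and `k < (q + 1)² ≤ (2 q)²`. The bound `2 q ≤ k` follows
-- from `q² ≤ k` when `q ≥ 2` and from `2 ≤ k` when `q = 1`; it will give each of `q` arms at least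
-- six steps.
√-scale : ∀ {k} → 2 ℕ.≤ k →
  ∃ λ q → 1 ℕ.≤ q × q ℕ.* q ℕ.≤ k × k ℕ.≤ 4 ℕ.* (q ℕ.* q) × 2 ℕ.* q ℕ.≤ k
√-scale {k} 2≤k with isqrt k
... | 0 , _ , k<1 = contradiction (ℕ.≤-trans 2≤k (ℕ.<⇒≤ k<1)) λ { (ℕ.s≤s ()) }
... | 1 , 1≤k , k<4 = 1 , ℕ.≤-refl , 1≤k , ℕ.<⇒≤ k<4 , 2≤k
... | q@(suc (suc p)) , q²≤k , k<[1+q]² = q , ℕ.s≤s ℕ.z≤n , q²≤k ,
  ℕ.≤-trans (ℕ.<⇒≤ k<[1+q]²) (ℕ.≤-trans (ℕ.*-mono-≤ 1+q≤2q 1+q≤2q)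
    (ℕ.≤-reflexive (ℕ.[m*n]*[o*p]≡[m*o]*[n*p] 2 q 2 q))) ,
  ℕ.≤-trans (ℕ.*-monoˡ-≤ q (ℕ.s≤s (ℕ.s≤s (ℕ.z≤n {p})))) q²≤k
  where
  1+q≤2q : suc q ℕ.≤ 2 ℕ.* q
  1+q≤2q = ℕ.+-mono-≤ {1} {q} {q} {q ℕ.+ 0} (ℕ.s≤s ℕ.z≤n) (ℕ.m≤m+n q 0)

module Analysis (ℛ : Reals) where
  open OrderedField ℛ
  open Bandits ℛ

  -- Sequences with diminishing returns.

  module Concave (g : ℕ → ℝ)
    (0≤g : ∀ t → 0# ≤ g t)
    (diminishing : ∀ t → g (suc (suc t)) - g (suc t) ≤ g (suc t) - g t)
    where

    slope : ℕ → ℝ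
    slope t = g (suc t) - g t

    slope-antitone : ∀ u t → slope (u ℕ.+ t) ≤ slope t
    slope-antitone zero    t = ≤-refl
    slope-antitone (suc u) t = ≤-trans (diminishing (u ℕ.+ t)) (slope-antitone u t)

    -- `g t` is `g 0 ≥ 0` plus `t` earlier increments, none smaller than the next one.
    slope-secant : ∀ t → fromℕ t * slope t ≤ g t
    slope-secant zero    = ≤-respˡ (sym (zeroˡ _)) (0≤g 0)
    slope-secant (suc t) =
      ≤-from (Δ (slope-secant t) ⊕ 0≤fromℕ (suc t) ⊗ Δ (diminishing t))
        (solve 4 (λ t g₀ g₁ g₂ →
            (con (+ 1) :+ t) :* (g₂ :- g₁) :+
            ((g₀ :- t :* (g₁ :- g₀)) :+ (con (+ 1) :+ t) :* ((g₁ :- g₀) :- (g₂ :- g₁)))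
            := g₁)
          refl (fromℕ t) (g t) (g (suc t)) (g (suc (suc t))))

    slope-secant′ : ∀ t → fromℕ (suc t) * slope t ≤ g (suc t)
    slope-secant′ t = ≤-from (Δ (slope-secant t))
      (solve 3 (λ t g₀ g₁ →
          (con (+ 1) :+ t) :* (g₁ :- g₀) :+ (g₀ :- t :* (g₁ :- g₀)) := g₁)
        refl (fromℕ t) (g t) (g (suc t)))

    -- The chord slope `g t / t` is nonincreasing, stated without division. It serves both to
    -- compare `f T` with `f τ` and to show that the best arm passes its tests.
    ratio-antitone : ∀ {t s} → t ℕ.≤ s → fromℕ t * g s ≤ fromℕ s * g t
    ratio-antitone {t} {s} t≤s =
      ≡.subst (λ s → fromℕ t * g s ≤ fromℕ s * g t) (ℕ.m∸n+n≡m t≤s) (from-distance (s ℕ.∸ t))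
      where
      from-distance : ∀ u → fromℕ t * g (u ℕ.+ t) ≤ fromℕ (u ℕ.+ t) * g t
      from-distance zero    = ≤-refl
      from-distance (suc u) =
        -- One more step adds `t * slope (u + t) ≤ t * slope t ≤ g t` on the left and exactly `g t`
        -- on the right.
        ≤-from (Δ (from-distance u) ⊕ Δ (slope-secant t) ⊕ 0≤fromℕ t ⊗ Δ (slope-antitone u t))
          (solve 6 (λ t x g₀ g₁ h₀ h₁ →
              t :* h₁ :+ ((x :* g₀ :- t :* h₀) :+ (g₀ :- t :* (g₁ :- g₀)) :+
                t :* ((g₁ :- g₀) :- (h₁ :- h₀)))
              := (con (+ 1) :+ x) :* g₀)
            refl (fromℕ t) (fromℕ (u ℕ.+ t)) (g t) (g (suc t)) (g (u ℕ.+ t)) (g (suc (u ℕ.+ t))))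

    -- Every later increment is at most `slope t`. This makes the extrapolation `m̂U` an upper bound
    -- for the final reward.
    tangent : ∀ t u → g (suc (u ℕ.+ t)) ≤ g (suc t) + slope t * fromℕ u
    tangent t zero    = ≤-reflexive (sym (trans (+-congˡ (zeroʳ _)) (+-identityʳ _)))
    tangent t (suc u) =
      ≤-from (Δ (tangent t u) ⊕ Δ (slope-antitone (suc u) t))
        (solve 5 (λ u g₀ g₁ h₁ h₂ →
            h₂ :+ ((g₁ :+ (g₁ :- g₀) :* u :- h₁) :+ ((g₁ :- g₀) :- (h₂ :- h₁)))
            := g₁ :+ (g₁ :- g₀) :* (con (+ 1) :+ u))
          refl (fromℕ u) (g t) (g (suc t)) (g (suc (u ℕ.+ t))) (g (suc (suc (u ℕ.+ t)))))

  -- Expectations of finite random computations.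

  ≤-𝔼-choose : ∀ {n} (g : Fin (suc n) → Rand ℝ) {z} →
    fromℕ (suc n) * z ≤ sum (λ i → 𝔼 (g i)) → z ≤ 𝔼 (choose g)
  ≤-𝔼-choose {n} g nz≤Σ = *-cancelˡ-≤ (0<fromℕ-suc n)
    (≤-respʳ (sym (*-cancel-/ (0<fromℕ-suc n) (sum (λ i → 𝔼 (g i))))) nz≤Σ)

  0≤𝔼-choose : ∀ {n} (g : Fin (suc n) → Rand ℝ) → (∀ i → 0# ≤ 𝔼 (g i)) → 0# ≤ 𝔼 (choose g)
  0≤𝔼-choose {n} g 0≤g = ≤-𝔼-choose g
    (≤-respˡ (sym (zeroʳ (fromℕ (suc n)))) (0≤sum {g = λ i → 𝔼 (g i)} 0≤g))

  0≤𝔼>>= : ∀ {A : Set} (x : Rand A) (h : A → Rand ℝ) →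
    (∀ a → 0# ≤ 𝔼 (h a)) → 0# ≤ 𝔼 (x >>= h)
  0≤𝔼>>= (return a) h 0≤h = 0≤h a
  0≤𝔼>>= (choose g) h 0≤h = 0≤𝔼-choose (λ i → g i >>= h) λ i → 0≤𝔼>>= (g i) h 0≤h

  𝔼-shift : ∀ a x → a + 𝔼 x ≤ 𝔼 (x >>= λ r → return (a + r))
  𝔼-shift a (return r) = ≤-refl
  𝔼-shift a (choose {n} g) = ≤-𝔼-choose (λ i → g i >>= λ r → return (a + r)) (≤-trans
    (≤-reflexive (trans
      (solve 3 (λ n a e → n :* (a :+ e) := n :* a :+ n :* e) refl (fromℕ (suc n)) a (𝔼 (choose g)))
      (+-congˡ (*-cancel-/ (0<fromℕ-suc n) _))))
    (sum-shift λ i → 𝔼-shift a (g i)))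
    where
    sum-shift : ∀ {m} {g h : Fin m → ℝ} → (∀ i → a + g i ≤ h i) → fromℕ m * a + sum g ≤ sum h
    sum-shift {zero}  a+g≤h = ≤-reflexive (trans (+-identityʳ _) (zeroˡ a))
    sum-shift {suc m} {g} {h} a+g≤h = ≤-respˡ
      (solve 4 (λ m a x y → a :+ x :+ (m :* a :+ y) := (con (+ 1) :+ m) :* a :+ (x :+ y))
        refl (fromℕ m) a (g zero) (sum (g ∘ suc)))
      (+-mono-≤ (a+g≤h zero) (sum-shift (a+g≤h ∘ suc)))

  𝔼-choose-≥ : ∀ {n} (g : Fin (suc n) → Rand ℝ) p → (∀ i → 0# ≤ 𝔼 (g i)) →
    𝔼 (g p) ≤ fromℕ (suc n) * 𝔼 (choose g)
  𝔼-choose-≥ {n} g p 0≤g = ≤-respʳ (sym (*-cancel-/ (0<fromℕ-suc n) _))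
    (≤-respˡ (trans (+-congˡ (zeroʳ (fromℕ n))) (+-identityʳ _))
      (≤-sum-except {g = λ i → 𝔼 (g i)} p ≤-refl λ i _ → 0≤g i))

  -- The single outcome `j` has probability `1 / (h + c + 1)`, and the other outcomes contribute
  -- nonnegatively. The endpoints enter through equations so that matching on them replaces the
  -- ceilings by literals.
  𝔼-uniform-≥ : ∀ {lo hi} c h j (F : ℤ → Rand ℝ) → lo ≡ ℤ.- + c → hi ≡ + h → j ℕ.≤ h →
    (∀ z → 0# ≤ 𝔼 (F z)) → 𝔼 (F (+ j)) ≤ fromℕ (suc (h ℕ.+ c)) * 𝔼 (uniform[ lo , hi ] >>= F)
  𝔼-uniform-≥ c h j F ≡.refl ≡.refl j≤h 0≤F =
    draw ℤ.∣ + h ℤ.- (ℤ.- + c) ∣ (≡.cong (λ z → ℤ.∣ + h ℤ.+ z ∣) (ℤ.neg-involutive (+ c)))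
    where
    G : ∀ {n} → Fin (suc n) → Rand ℝ
    G i = F (ℤ.- + c ℤ.+ + toℕ i)

    -- The number of outcomes is generalised because `h - (- c)` equals `h + c` only
    -- propositionally. The value `j` sits at index `j + c`.
    draw : ∀ n → n ≡ h ℕ.+ c → 𝔼 (F (+ j)) ≤ fromℕ (suc (h ℕ.+ c)) * 𝔼 (choose {n = n} G)
    draw n ≡.refl = ≤-respˡ (reflexive (≡.cong (λ z → 𝔼 (F z)) value))
      (𝔼-choose-≥ G p λ i → 0≤F (ℤ.- + c ℤ.+ + toℕ i))
      where
      p : Fin (suc n)
      p = fromℕ< (ℕ.s≤s (ℕ.+-monoˡ-≤ c j≤h))

      value : ℤ.- + c ℤ.+ + toℕ p ≡ + j
      value = ≡.trans (≡.cong (λ t → ℤ.- + c ℤ.+ + t)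
          (≡.trans (Fin.toℕ-fromℕ< _) (ℕ.+-comm j c)))
        (≡.trans (≡.sym (ℤ.+-assoc (ℤ.- + c) (+ c) (+ j)))
          (≡.trans (≡.cong (ℤ._+ + j) (ℤ.+-inverseˡ (+ c))) (ℤ.+-identityˡ (+ j))))

  -- Rewards and time consumption in Random Round Robin.

  module RoundRobinAnalysis
    {k : ℕ} .{{_ : NonZero k}} (I : Instance k) (m : ℝ) (τ N : ℕ) where
    open Instance I
    open RoundRobin I m τ N

    reward : Fin k → ℕ → ℕ → ℝ
    reward i t s = proj₁ (pull i t s)

    left : Fin k → ℕ → ℕ → ℕ
    left i t s = proj₂ (pull i t s)

    0≤reward : ∀ i t s → 0# ≤ reward i t s
    0≤reward i t zero    = ≤-refl
    0≤reward i t (suc s) with m * fromℕ t / fromℕ τ ≤? f i (N ℕ.+ t)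
    ... | yes _ = nonneg i _ ⊕ 0≤reward i (suc t) s
    ... | no _  = ≤-refl

    -- Such an arm can be abandoned only at a counter beyond `τ`, so it consumes either all `s`
    -- steps or at least `τ - t` of them.
    left-≤ : ∀ {i} → (∀ t → t ℕ.≤ τ → m * fromℕ t / fromℕ τ ≤ f i (N ℕ.+ t)) →
      ∀ t s → left i t s ℕ.≤ (s ℕ.+ t) ℕ.∸ τ
    left-≤ holds t zero    = ℕ.z≤n
    left-≤ {i} holds t (suc s) with m * fromℕ t / fromℕ τ ≤? f i (N ℕ.+ t)
    ... | yes _   = ≡.subst (λ x → left i (suc t) s ℕ.≤ x ℕ.∸ τ) (ℕ.+-suc s t)
        (left-≤ holds (suc t) s)
    ... | no fails with t ℕ.≤? τ
    ...   | yes t≤τ = contradiction (holds t t≤τ) fails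
    ...   | no t≰τ  = ≡.subst (suc s ℕ.≤_) (≡.sym (ℕ.+-∸-assoc (suc s) (ℕ.≰⇒≥ t≰τ)))
        (ℕ.m≤m+n (suc s) _)

    -- Every pull at counter t yields at least m t / τ = 16 u t, so a pulls yield
    -- about 8 u a²; this is the tangent of that parabola at a = θ / 2.
    reward-≥ : ∀ {u} → 0# ≤ u → (∀ t {x} → m * fromℕ t / fromℕ τ ≤ x → fromℕ 16 * u * fromℕ t ≤ x) →
      ∀ θ i t s → fromℕ 8 * u * (θ - 1#) * fromℕ s ≤
        reward i t s + fromℕ 8 * u * (θ - 1#) * fromℕ (left i t s) +
        2# * u * ((θ - 2# * fromℕ t) * (θ - 2# * fromℕ t))
    reward-≥ {u} 0≤u test θ i t s = go t s
      where
      stop : ∀ t s → fromℕ 8 * u * (θ - 1#) * fromℕ s ≤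
        0# + fromℕ 8 * u * (θ - 1#) * fromℕ s + 2# * u * ((θ - 2# * fromℕ t) * (θ - 2# * fromℕ t))
      stop t s = ≤-from (0≤fromℕ 2 ⊗ 0≤u ⊗ 0≤x² (θ - 2# * fromℕ t))
        (solve 2 (λ x y → x :+ y := con (+ 0) :+ x :+ y) refl _ _)

      go : ∀ t s → fromℕ 8 * u * (θ - 1#) * fromℕ s ≤
        reward i t s + fromℕ 8 * u * (θ - 1#) * fromℕ (left i t s) +
        2# * u * ((θ - 2# * fromℕ t) * (θ - 2# * fromℕ t))
      go t zero    = stop t 0
      go t (suc s) with m * fromℕ t / fromℕ τ ≤? f i (N ℕ.+ t)
      ... | no _  = stop t (suc s)
      ... | yes p = ≤-from
        -- From counter `t` to `t + 1` the square term falls by `8 u (θ - 1) - 16 u t`. The pull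
        -- pays `f (N + t + 1)`, which by monotonicity is at least the reward just tested, hence at
        -- least `16 u t`.
        (Δ (go (suc t) s) ⊕ Δ (test t (≤-trans p (monotone i (ℕ.+-monoʳ-≤ N (ℕ.n≤1+n t))))))
        (solve 7 (λ u θ t s r l f →
            con (+ 8) :* u :* (θ :- con (+ 1)) :* (con (+ 1) :+ s) :+
            ((r :+ con (+ 8) :* u :* (θ :- con (+ 1)) :* l :+
              con (+ 2) :* u :* ((θ :- con (+ 2) :* (con (+ 1) :+ t)) :*
                (θ :- con (+ 2) :* (con (+ 1) :+ t)))
              :- con (+ 8) :* u :* (θ :- con (+ 1)) :* s) :+ (f :- con (+ 16) :* u :* t))
            := f :+ r :+ con (+ 8) :* u :* (θ :- con (+ 1)) :* l :+
              con (+ 2) :* u :* ((θ :- con (+ 2) :* t) :* (θ :- con (+ 2) :* t)))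
          refl u θ (fromℕ t) (fromℕ s) (reward i (suc t) s) (fromℕ (left i (suc t) s))
            (f i (N ℕ.+ suc t)))

    play : ∀ {n} → Vec (Fin k) (suc n) → ℕ → Fin (suc n) → Rand ℝ
    play arms s p = run (removeAt arms p) (left (lookup arms p) 0 s) >>= λ r →
      return (reward (lookup arms p) 0 s + r)

    play-≥ : ∀ {n} (arms : Vec (Fin k) (suc n)) s p →
      reward (lookup arms p) 0 s + 𝔼 (run (removeAt arms p) (left (lookup arms p) 0 s)) ≤
      𝔼 (play arms s p)
    play-≥ arms s p = 𝔼-shift _ (run (removeAt arms p) (left (lookup arms p) 0 s))

    0≤𝔼-run : ∀ {n} (arms : Vec (Fin k) n) s → 0# ≤ 𝔼 (run arms s)
    0≤𝔼-run         arms zero    = ≤-refl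
    0≤𝔼-run {zero}  arms (suc s) = ≤-refl
    0≤𝔼-run {suc n} arms (suc s) = 0≤𝔼-choose (play arms (suc s)) λ p →
      ≤-trans (0≤reward (lookup arms p) 0 (suc s) ⊕
          0≤𝔼-run (removeAt arms p) (left (lookup arms p) 0 (suc s)))
        (play-≥ arms (suc s) p)

    -- `u` solves `(n + 1) z = B + n u`: one draw worth `B` and `n` draws worth `u` average to `z`.
    -- Since `q ≤ n`, the hypothesis gives `z ≤ B` and so `u ≤ z`. For `n = 0` there are no other
    -- draws and `u = z` is a placeholder.
    redistribute : ∀ {n q z B} → 0# ≤ B → q ℕ.≤ n →
      fromℕ (suc n) * z ≤ fromℕ (suc q) * B →
      ∃ λ u → u ≤ z × fromℕ (suc n) * z ≤ B + fromℕ n * u × fromℕ n * u ≤ fromℕ q * B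
    redistribute {zero} {zero} {z} {B} 0≤B _ nz≤qB = z , ≤-refl ,
      ≤-from (Δ nz≤qB)
        (solve 2 (λ z b → (con (+ 1) :+ con (+ 0)) :* z :+
            ((con (+ 1) :+ con (+ 0)) :* b :- (con (+ 1) :+ con (+ 0)) :* z)
            := b :+ con (+ 0) :* z) refl z B) ,
      ≤-reflexive (trans (zeroˡ z) (sym (zeroˡ B)))
    redistribute {suc n} {q} {z} {B} 0≤B q≤n nz≤qB = u , *-cancelˡ-≤ (0<fromℕ-suc n) nu≤nz ,
      ≤-reflexive (trans (solve 2 (λ x b → x := b :+ (x :- b)) refl _ B) (+-congˡ (sym nu))) ,
      ≤-respˡ (sym nu) (≤-from (Δ nz≤qB)
        (solve 3 (λ x q b → x :- b :+ ((con (+ 1) :+ q) :* b :- x) := q :* b) refl _ (fromℕ q) B))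
      where
      ν = fromℕ (suc n)
      u = (fromℕ (suc (suc n)) * z - B) / ν

      nu : ν * u ≈ fromℕ (suc (suc n)) * z - B
      nu = *-cancel-/ (0<fromℕ-suc n) _

      z≤B : z ≤ B
      z≤B = *-cancelˡ-≤ (0<fromℕ-suc (suc n)) (≤-trans nz≤qB
        (*-mono-≤ (0≤fromℕ (suc q)) 0≤B (fromℕ-mono (ℕ.s≤s q≤n)) ≤-refl))

      nu≤nz : ν * u ≤ ν * z
      nu≤nz = ≤-respˡ (sym nu) (≤-from (Δ z≤B)
        (solve 3 (λ n z b → (con (+ 1) :+ n) :* z :- b :+ (b :- z) := n :* z) refl ν z B))

    -- H is the number of steps the best arm needs in order to yield B. Either the
    -- first q arms burn all but H of the steps, which is worth β (s - H) - q γ, or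
    -- with probability q / n the best arm is among them. The induction goes through
    -- for any z below both values: a first draw of the best arm yields B, and the
    -- surplus B - z over z relaxes the bound for the other draws from z to u.
    𝔼-run-≥ : ∀ {best β γ B H} → 0# ≤ β → 0# ≤ γ → 0# ≤ B → 0# ≤ H →
      (∀ i s → β * fromℕ s ≤ reward i 0 s + β * fromℕ (left i 0 s) + γ) →
      (∀ s → H ≤ fromℕ s → B ≤ reward best 0 s) →
      ∀ {n q z} (arms : Vec (Fin k) n) p s → lookup arms p ≡ best → q ℕ.≤ n →
      z + β * H + fromℕ q * γ ≤ β * fromℕ s → fromℕ n * z ≤ fromℕ q * B →
      z ≤ 𝔼 (run arms s)
    𝔼-run-≥ {best} {β} {γ} {B} {H} 0≤β 0≤γ 0≤B 0≤H cost gain = go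
      where
      -- With at most `H` steps left the time budget covers no positive `z`, so nonnegativity of the
      -- reward is enough.
      exhausted : ∀ {z s} q → fromℕ s ≤ H → z + β * H + fromℕ q * γ ≤ β * fromℕ s → z ≤ 0#
      exhausted {z} {s} q s≤H z≤ = ≤-from (Δ z≤ ⊕ 0≤fromℕ q ⊗ 0≤γ ⊕ 0≤β ⊗ Δ s≤H)
        (solve 6 (λ z β H q γ s →
            z :+ (β :* s :- (z :+ β :* H :+ q :* γ) :+ q :* γ :+ β :* (H :- s)) := con (+ 0))
          refl z β H (fromℕ q) γ (fromℕ s))

      go : ∀ {n q z} (arms : Vec (Fin k) n) p s → lookup arms p ≡ best → q ℕ.≤ n →
        z + β * H + fromℕ q * γ ≤ β * fromℕ s → fromℕ n * z ≤ fromℕ q * B →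
        z ≤ 𝔼 (run arms s)
      go {q = q} arms p zero _ _ z≤ _ = exhausted {s = 0} q 0≤H z≤
      go {suc n} {zero} arms p (suc s) _ _ _ nz≤0 =
        ≤-trans (*-cancelˡ-≤ (0<fromℕ-suc n) (≤-respʳ (trans (zeroˡ B) (sym (zeroʳ _))) nz≤0))
          (0≤𝔼-run arms (suc s))
      go {suc n} {suc q} {z} arms p (suc s) arms[p]≡best (ℕ.s≤s q≤n) z≤ nz≤qB
        with total (fromℕ (suc s)) H
      ... | inj₁ s≤H = ≤-trans (exhausted {s = suc s} (suc q) s≤H z≤) (0≤𝔼-run arms (suc s))
      ... | inj₂ H≤s with redistribute {z = z} 0≤B q≤n nz≤qB
      ...   | u , u≤z , nz≤ , nu≤qB = ≤-𝔼-choose (play arms (suc s))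
        (≤-trans nz≤ (≤-sum-except {g = λ i → 𝔼 (play arms (suc s) i)} p
          (≤-trans best-first (play-≥ arms (suc s) p))
          λ i i≢p → ≤-trans (other-first i i≢p) (play-≥ arms (suc s) i)))
        where
        best-first : B ≤ reward (lookup arms p) 0 (suc s) +
          𝔼 (run (removeAt arms p) (left (lookup arms p) 0 (suc s)))
        best-first = ≤-respˡ (+-identityʳ B) (+-mono-≤
          (≡.subst (λ i → B ≤ reward i 0 (suc s)) (≡.sym arms[p]≡best) (gain (suc s) H≤s))
          (0≤𝔼-run (removeAt arms p) (left (lookup arms p) 0 (suc s))))

        other-first : ∀ i → i ≢ p →
          u ≤ reward (lookup arms i) 0 (suc s) +
            𝔼 (run (removeAt arms i) (left (lookup arms i) 0 (suc s)))
        -- The reward `r` is already collected, so the remaining run has to yield only `u - r`. The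
        -- `cost` bound shows that the steps spent on this arm are paid for by `r` and one `γ`,
        -- which takes `q + 1` to `q`.
        other-first i i≢p = ≤-from (Δ (go {z = u - r} (removeAt arms i) (punchOut i≢p) s′
            (≡.trans (removeAt-punchOut arms i≢p) arms[p]≡best) q≤n
            (≤-from (Δ u≤z ⊕ Δ z≤ ⊕ Δ (cost (lookup arms i) (suc s)))
              (solve 9 (λ u z r β H q γ s l →
                  u :- r :+ β :* H :+ q :* γ :+ (z :- u :+
                    (β :* s :- (z :+ β :* H :+ (con (+ 1) :+ q) :* γ)) :+
                    (r :+ β :* l :+ γ :- β :* s))
                  := β :* l)
                refl u z r β H (fromℕ q) γ (fromℕ (suc s)) (fromℕ s′)))
            (≤-trans (*-monoˡ-≤ (0≤fromℕ n) (≤-from (0≤reward (lookup arms i) 0 (suc s))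
              (solve 2 (λ u r → u :- r :+ r := u) refl u r))) nu≤qB)))
          (solve 3 (λ u r e → u :+ (e :- (u :- r)) := r :+ e) refl u r (𝔼 (run (removeAt arms i) s′)))
          where
          r  = reward (lookup arms i) 0 (suc s)
          s′ = left (lookup arms i) 0 (suc s)

  -- The second phase with a threshold not exceeding the best arm's value.

  module SecondPhase
    {k : ℕ} .{{_ : NonZero k}} (I : Instance k) where
    open Instance I

    module Arm (i : Fin k) = Concave (f i) (nonneg i) (diminishing i)

    𝔼-randomRoundRobin-≥ : ∀ {m τ} N {S q} best →
      0# ≤ m → m ≤ f best τ → 1 ℕ.≤ τ → τ ℕ.≤ S → S ℕ.≤ 2 ℕ.* τ →
      1 ℕ.≤ q → 6 ℕ.* q ℕ.≤ S → q ℕ.≤ k → k ℕ.≤ 4 ℕ.* (q ℕ.* q) →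
      m * fromℕ S ≤ fromℕ 64 * fromℕ q * 𝔼 (randomRoundRobin I m τ N S)
    𝔼-randomRoundRobin-≥ {m} {τ@(suc τ₁)} N {S} {q@(suc q₁)} best
      0≤m m≤fτ 1≤τ τ≤S S≤2τ 1≤q 6q≤S q≤k k≤4q² =
      ≤-trans mS≤64qz (*-monoˡ-≤ (0≤fromℕ 64 ⊗ 0≤Q) z≤𝔼)
      where
      open RoundRobinAnalysis I m τ N

      -- `H = S / 2` is half of the time and `θ / 2 = H / (2 q)` is the tangent point. With
      -- `u = m / (16 τ)` the test demands `16 u t`. The target is `z = m S² / (64 τ q)`, and `B` is
      -- half of the ideal yield `8 u H²`, which leaves room for the discretisation.
      Q = fromℕ q
      t = fromℕ τ
      θ = fromℕ S / (2# * Q)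
      u = m / (fromℕ 16 * t)
      H = Q * θ
      z = u * Q * (θ * θ)
      β = fromℕ 8 * u * (θ - 1#)
      γ = 2# * u * (θ * θ)
      B = fromℕ 4 * u * (H * H)

      0≤Q : 0# ≤ Q
      0≤Q = 0≤fromℕ q

      0<2Q : 0# < 2# * Q
      0<2Q = *-pos 0<2 (0<fromℕ-suc q₁)

      0<16t : 0# < fromℕ 16 * t
      0<16t = *-pos (0<fromℕ-suc 15) (0<fromℕ-suc τ₁)

      S≈2Qθ : 2# * Q * θ ≈ fromℕ S
      S≈2Qθ = *-cancel-/ 0<2Q (fromℕ S)

      m≈16tu : fromℕ 16 * t * u ≈ m
      m≈16tu = *-cancel-/ 0<16t m

      3≤θ : fromℕ 3 ≤ θ
      3≤θ = *-cancelˡ-≤ 0<2Q (≤-respʳ (sym S≈2Qθ) (≤-respˡ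
        (trans (fromℕ-* 6 q) (solve 1 (λ q → con (+ 6) :* q := con (+ 2) :* q :* con (+ 3)) refl Q))
        (fromℕ-mono 6q≤S)))

      0≤θ : 0# ≤ θ
      0≤θ = ≤-trans (0≤fromℕ 3) 3≤θ

      0≤θ-1 : 0# ≤ θ - 1#
      0≤θ-1 = ≤-from (0≤fromℕ 2 ⊕ Δ 3≤θ)
        (solve 1 (λ θ → con (+ 0) :+ (con (+ 2) :+ (θ :- con (+ 3))) := θ :- con (+ 1)) refl θ)

      0≤u : 0# ≤ u
      0≤u = 0≤m ⊗ 0≤⁻¹ 0<16t

      0≤H : 0# ≤ H
      0≤H = 0≤Q ⊗ 0≤θ

      3≤H : fromℕ 3 ≤ H
      3≤H = ≤-trans 3≤θ (≤-respˡ (*-identityˡ θ)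
        (*-mono-≤ 0≤1 0≤θ (≤-respˡ fromℕ-1 (fromℕ-mono 1≤q)) ≤-refl))

      H≤τ : H ≤ t
      H≤τ = *-cancelˡ-≤ 0<2 (≤-respˡ (trans (sym S≈2Qθ) (*-assoc 2# Q θ))
        (≤-respʳ (fromℕ-* 2 τ) (fromℕ-mono S≤2τ)))

      threshold : ∀ s → m * fromℕ s / t ≈ fromℕ 16 * u * fromℕ s
      threshold s = trans
        (*-congʳ (trans (*-congʳ (sym m≈16tu))
          (solve 3 (λ t u s → con (+ 16) :* t :* u :* s := con (+ 16) :* u :* s :* t)
            refl t u (fromℕ s))))
        (trans (*-assoc _ t (t ⁻¹))
          (trans (*-congˡ (*-inverseʳ (0<⇒≉0 (0<fromℕ-suc τ₁)))) (*-identityʳ _)))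

      test : ∀ s {x} → m * fromℕ s / t ≤ x → fromℕ 16 * u * fromℕ s ≤ x
      test s = ≤-respˡ (threshold s)

      -- By concavity `m s / τ ≤ f τ * s / τ ≤ f s`, and pulls from the first phase only raise the
      -- reward.
      holds : ∀ s → s ℕ.≤ τ → m * fromℕ s / t ≤ f best (N ℕ.+ s)
      holds s s≤τ = ≤-trans
        (*-cancelˡ-≤ (0<fromℕ-suc τ₁) (≤-respˡ (sym (*-cancel-/ (0<fromℕ-suc τ₁) _))
          (≤-trans (≤-respˡ (*-comm (fromℕ s) m) (*-monoˡ-≤ (0≤fromℕ s) m≤fτ))
            (Arm.ratio-antitone best s≤τ))))
        (monotone best (ℕ.m≤n+m s N))

      cost : ∀ i s → β * fromℕ s ≤ reward i 0 s + β * fromℕ (left i 0 s) + γ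
      cost i s = ≤-respʳ (+-congˡ (solve 2 (λ u θ →
          con (+ 2) :* u :* ((θ :- con (+ 2) :* con (+ 0)) :* (θ :- con (+ 2) :* con (+ 0)))
          := con (+ 2) :* u :* (θ :* θ)) refl u θ))
        (reward-≥ 0≤u test θ i 0 s)

      -- The best arm consumes at least `τ ≥ H` steps if that many remain, and otherwise all of
      -- them.
      enough : ∀ s → H ≤ fromℕ s → H + fromℕ (left best 0 s) ≤ fromℕ s
      enough s H≤s with τ ℕ.≤? s | ≡.subst (λ x → left best 0 s ℕ.≤ x ℕ.∸ τ) (ℕ.+-identityʳ s)
                                     (left-≤ holds 0 s)
      ... | yes τ≤s | left≤ = ≤-trans (+-mono-≤ H≤τ (fromℕ-mono left≤))
        (≤-reflexive (trans (sym (fromℕ-+ τ (s ℕ.∸ τ)))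
          (reflexive (≡.cong fromℕ (ℕ.m+[n∸m]≡n τ≤s)))))
      ... | no τ≰s  | left≤ = ≤-trans
        (+-mono-≤ H≤s (fromℕ-mono (ℕ.≤-trans left≤
          (ℕ.≤-reflexive (ℕ.m≤n⇒m∸n≡0 (ℕ.≰⇒≥ τ≰s))))))
        (≤-reflexive (+-identityʳ _))

      gain : ∀ s → H ≤ fromℕ s → B ≤ reward best 0 s
      gain s H≤s = ≤-from
        -- The tangent is now taken at `H` pulls and gives `8 u H (H - 1)`, which is at least
        -- `4 u H²` because `H ≥ 3`.
        (Δ (reward-≥ 0≤u test (2# * H) best 0 s)
          ⊕ 0≤fromℕ 8 ⊗ 0≤u ⊗ (0≤H ⊕ (0≤fromℕ 2 ⊕ Δ 3≤H)) ⊗ Δ (enough s H≤s)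
          ⊕ 0≤fromℕ 4 ⊗ 0≤u ⊗ 0≤H ⊗ (0≤1 ⊕ Δ 3≤H))
        (solve 5 (λ u h s l r →
            con (+ 4) :* u :* (h :* h) :+
            ((r :+ con (+ 8) :* u :* (con (+ 2) :* h :- con (+ 1)) :* l :+
                con (+ 2) :* u :* ((con (+ 2) :* h :- con (+ 2) :* con (+ 0)) :*
                  (con (+ 2) :* h :- con (+ 2) :* con (+ 0)))
                :- con (+ 8) :* u :* (con (+ 2) :* h :- con (+ 1)) :* s) :+
              con (+ 8) :* u :* (h :+ (con (+ 2) :+ (h :- con (+ 3)))) :* (s :- (h :+ l)) :+
              con (+ 4) :* u :* h :* (con (+ 1) :+ (h :- con (+ 3))))
            := r)
          refl u H (fromℕ s) (fromℕ (left best 0 s)) (reward best 0 s))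

      z≤𝔼 : z ≤ 𝔼 (randomRoundRobin I m τ N S)
      z≤𝔼 = 𝔼-run-≥ {best} {β} {γ} {B} {H} (0≤fromℕ 8 ⊗ 0≤u ⊗ 0≤θ-1)
        (0≤fromℕ 2 ⊗ 0≤u ⊗ (0≤θ ⊗ 0≤θ)) (0≤fromℕ 4 ⊗ 0≤u ⊗ (0≤H ⊗ 0≤H)) 0≤H cost gain
        {q = q} {z = z} (allFin k) best S (lookup-allFin best) q≤k
        (≤-respʳ (*-congˡ S≈2Qθ)
          -- After dividing by `u q θ` the budget reads `3 θ ≤ 8 (θ - 1)`, which holds since
          -- `θ ≥ 3`.
          (≤-from (0≤u ⊗ 0≤Q ⊗ 0≤θ ⊗ (0≤fromℕ 5 ⊗ Δ 3≤θ ⊕ 0≤fromℕ 7))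
            (solve 3 (λ u q θ →
                u :* q :* (θ :* θ) :+ con (+ 8) :* u :* (θ :- con (+ 1)) :* (q :* θ) :+
                q :* (con (+ 2) :* u :* (θ :* θ)) :+
                u :* q :* θ :* (con (+ 5) :* (θ :- con (+ 3)) :+ con (+ 7))
                := con (+ 8) :* u :* (θ :- con (+ 1)) :* (con (+ 2) :* q :* θ))
              refl u Q θ)))
        (≤-from (0≤u ⊗ 0≤Q ⊗ (0≤θ ⊗ 0≤θ) ⊗ Δ k≤4Q²)
          (solve 4 (λ k u q θ →
              k :* (u :* q :* (θ :* θ)) :+ u :* q :* (θ :* θ) :* (con (+ 4) :* (q :* q) :- k)
              := q :* (con (+ 4) :* u :* (q :* θ :* (q :* θ))))
            refl (fromℕ k) u Q θ))
        where
        k≤4Q² : fromℕ k ≤ fromℕ 4 * (Q * Q)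
        k≤4Q² = ≤-respʳ (trans (fromℕ-* 4 (q ℕ.* q)) (*-congˡ (fromℕ-* q q))) (fromℕ-mono k≤4q²)

      -- `64 q z = 16 u S²` while `m S = 16 u τ S`, so this is `τ ≤ S`.
      mS≤64qz : m * fromℕ S ≤ fromℕ 64 * Q * z
      mS≤64qz = ≤-respˡ (*-cong m≈16tu S≈2Qθ)
        (≤-from (0≤fromℕ 32 ⊗ 0≤u ⊗ 0≤H ⊗ Δ (≤-respʳ (sym S≈2Qθ) (fromℕ-mono τ≤S)))
          (solve 4 (λ t u q θ →
              con (+ 16) :* t :* u :* (con (+ 2) :* q :* θ) :+
              con (+ 32) :* u :* (q :* θ) :* (con (+ 2) :* q :* θ :- t)
              := con (+ 64) :* q :* (u :* q :* (θ :* θ)))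
            refl t u Q θ))

  -- The factor 12 comes from `OPT ≤ 6 S μ` and `μ ≤ 2 m`, 64 from the second phase, and 7 from the
  -- at most `7 ℓ` values of `j`.
  C : ℝ
  C = fromℕ 12 * fromℕ 64 * fromℕ 7

  0<C : 0# < C
  0<C = *-pos (*-pos (0<fromℕ-suc 11) (0<fromℕ-suc 63)) (0<fromℕ-suc 6)

  0≤C : 0# ≤ C
  0≤C = proj₁ 0<C

  C-chain : ∀ {opt s μ m q ℓ e₂ e} → 0# ≤ s → 0# ≤ q →
    opt ≤ fromℕ 6 * s * μ → μ ≤ 2# * m → m * s ≤ fromℕ 64 * q * e₂ →
    e₂ ≤ fromℕ 7 * ℓ * e → opt ≤ C * (q * ℓ) * e
  C-chain {opt} {s} {μ} {m} {q} {ℓ} {e₂} {e} 0≤s 0≤q opt≤ μ≤ ms≤ e₂≤ = ≤-trans opt≤ (≤-from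
    (0≤fromℕ 6 ⊗ 0≤s ⊗ Δ μ≤ ⊕ 0≤fromℕ 12 ⊗ Δ ms≤ ⊕ 0≤fromℕ 12 ⊗ (0≤fromℕ 64 ⊗ 0≤q) ⊗ Δ e₂≤)
    (solve 9 (λ a b s μ m q ℓ e₂ e →
        con (+ 6) :* s :* μ :+
        (con (+ 6) :* s :* (con (+ 2) :* m :- μ) :+
          con (+ 12) :* (a :* q :* e₂ :- m :* s) :+
          con (+ 12) :* (a :* q) :* (b :* ℓ :* e :- e₂))
        := con (+ 12) :* a :* b :* (q :* ℓ) :* e)
      refl (fromℕ 64) (fromℕ 7) s μ m q ℓ e₂ e))

  -- Both phases combined, for a horizon `T = 2 k (n + 1)`.

  module Main
    {k : ℕ} .{{_ : NonZero k}} (I : Instance k) (2≤k : 2 ℕ.≤ k) (n : ℕ) (2≤n : 2 ℕ.≤ n) where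
    open Instance I
    open SecondPhase I

    -- Writing `T / (2k)` as `n + 1` removes all divisions, and `T / 2 - k` becomes `n k`. The
    -- condition `T > 4k` is `n ≥ 2`.
    N τ S T : ℕ
    N = suc n
    τ = n ℕ.* k
    S = suc n ℕ.* k
    T = suc n ℕ.* (2 ℕ.* k)

    T≡2S : T ≡ 2 ℕ.* S
    T≡2S = ≡.trans (≡.sym (ℕ.*-assoc (suc n) 2 k))
      (≡.trans (≡.cong (ℕ._* k) (ℕ.*-comm (suc n) 2)) (ℕ.*-assoc 2 (suc n) k))

    1≤n : 1 ℕ.≤ n
    1≤n = ℕ.≤-trans (ℕ.n≤1+n 1) 2≤n

    0<k : 0 ℕ.< k
    0<k = ℕ.≤-trans (ℕ.n≤1+n 1) 2≤k

    1≤τ : 1 ℕ.≤ τ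
    1≤τ = ℕ.*-mono-≤ 1≤n 0<k

    τ≤S : τ ℕ.≤ S
    τ≤S = ℕ.m≤n+m τ k

    S≤2τ : S ℕ.≤ 2 ℕ.* τ
    S≤2τ = ℕ.≤-trans (ℕ.*-monoˡ-≤ k (ℕ.+-mono-≤ 1≤n (ℕ.m≤m+n n 0)))
      (ℕ.≤-reflexive (ℕ.*-assoc 2 n k))

    T≤3τ : T ℕ.≤ 3 ℕ.* τ
    T≤3τ = ℕ.≤-trans (ℕ.≤-reflexive (≡.sym (ℕ.*-assoc (suc n) 2 k)))
      (ℕ.≤-trans (ℕ.*-monoˡ-≤ k 2+2n≤3n) (ℕ.≤-reflexive (ℕ.*-assoc 3 n k)))
      where
      2+2n≤3n : suc n ℕ.* 2 ℕ.≤ 3 ℕ.* n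
      2+2n≤3n = ℕ.+-mono-≤ {2} {n} 2≤n (ℕ.≤-reflexive (ℕ.*-comm n 2))

    τ≤T : τ ℕ.≤ T
    τ≤T = ℕ.≤-trans τ≤S (ℕ.≤-trans (ℕ.m≤m+n S (S ℕ.+ 0)) (ℕ.≤-reflexive (≡.sym T≡2S)))

    N≤τ : N ℕ.≤ τ
    N≤τ = ℕ.≤-trans (ℕ.+-mono-≤ 1≤n (ℕ.≤-reflexive (≡.sym (ℕ.+-identityʳ n))))
      (ℕ.≤-trans (ℕ.≤-reflexive (ℕ.*-comm 2 n)) (ℕ.*-monoʳ-≤ n 2≤k))

    W : ℕ
    W = T ℕ.∸ N

    W+N≡T : W ℕ.+ N ≡ T
    W+N≡T = ℕ.m∸n+n≡m (ℕ.≤-trans N≤τ τ≤T)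

    m̂U : Fin k → ℝ
    m̂U i = f i N + (f i N - f i n) * fromℕ W

    M L U : ℝ
    M = max (λ i → f i N)
    L = M / 2#
    U = max m̂U

    f[T]≤m̂U : ∀ i → f i T ≤ m̂U i
    f[T]≤m̂U i = ≡.subst (λ t → f i t ≤ m̂U i) (≡.trans (≡.sym (ℕ.+-suc W n)) W+N≡T)
      (Arm.tangent i n W)

    -- The last observed increment is at most `f N / N`, so extrapolating it to `T = 2 k N`
    -- multiplies `f N` by at most `2 k`.
    m̂U≤ : ∀ i → m̂U i ≤ fromℕ 2 * fromℕ k * f i N
    m̂U≤ i = ≤-from (0≤2k-1 ⊗ Δ (Arm.slope-secant′ i n))
      (trans (+-congʳ (+-congˡ (*-congˡ W≈)))
        (solve 4 (λ n k g₀ g₁ →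
            g₁ :+ (g₁ :- g₀) :* (n :* (con (+ 2) :* k) :- n) :+
              (con (+ 2) :* k :- con (+ 1)) :* (g₁ :- n :* (g₁ :- g₀))
            := con (+ 2) :* k :* g₁)
          refl (fromℕ N) (fromℕ k) (f i n) (f i N)))
      where
      0≤2k-1 : 0# ≤ fromℕ 2 * fromℕ k - 1#
      0≤2k-1 = Δ (≤-respʳ (fromℕ-* 2 k) (≤-respˡ fromℕ-1
        (fromℕ-mono (ℕ.*-mono-≤ {1} {2} {1} (ℕ.n≤1+n 1) 0<k))))

      W≈ : fromℕ W ≈ fromℕ N * (fromℕ 2 * fromℕ k) - fromℕ N
      W≈ = trans (solve 2 (λ w n → w := w :+ n :- n) refl (fromℕ W) (fromℕ N))
        (+-congʳ (trans (sym (fromℕ-+ W N)) (trans (reflexive (≡.cong fromℕ W+N≡T))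
          (trans (fromℕ-* N (2 ℕ.* k)) (*-congˡ (fromℕ-* 2 k))))))

    U≤2kM : U ≤ fromℕ 2 * fromℕ k * M
    U≤2kM = max-≤ λ i → ≤-trans (m̂U≤ i)
      (*-monoˡ-≤ (0≤fromℕ 2 ⊗ 0≤fromℕ k) (≤-max (λ i → f i N) i))

    f[T]≤3f[τ] : ∀ i → f i T ≤ fromℕ 3 * f i τ
    f[T]≤3f[τ] i = *-cancelˡ-≤ (0<fromℕ 1≤τ) (≤-trans (Arm.ratio-antitone i τ≤T)
      (≤-respʳ (trans (*-congʳ (fromℕ-* 3 τ))
          (solve 2 (λ t f → con (+ 3) :* t :* f := t :* (con (+ 3) :* f)) refl (fromℕ τ) (f i τ)))
        (*-mono-≤ (0≤fromℕ T) (nonneg i τ) (fromℕ-mono T≤3τ) ≤-refl)))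

    0<fromℕ-τ : 0# < fromℕ τ
    0<fromℕ-τ = 0<fromℕ 1≤τ

    best : Fin k
    best = proj₁ (argmax λ i → f i τ)

    μ : ℝ
    μ = f best τ

    f[τ]≤μ : ∀ i → f i τ ≤ μ
    f[τ]≤μ = proj₂ (argmax λ i → f i τ)

    OPT≤6Sμ : OPT I T ≤ fromℕ 6 * fromℕ S * μ
    OPT≤6Sμ = max-≤ λ i → ≤-trans
      (sum-≤ {g = λ t → f i (suc (toℕ t))} λ t → ≤-trans (monotone i (Fin.toℕ<n t))
        (≤-trans (f[T]≤3f[τ] i) (*-monoˡ-≤ (0≤fromℕ 3) (f[τ]≤μ i))))
      (≤-reflexive (trans (*-congʳ (trans (reflexive (≡.cong fromℕ T≡2S)) (fromℕ-* 2 S)))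
        (solve 2 (λ s m → con (+ 2) :* s :* (con (+ 3) :* m) := con (+ 6) :* s :* m)
          refl (fromℕ S) μ)))

    M≤μ : M ≤ μ
    M≤μ = max-≤ λ i → ≤-trans (monotone i N≤τ) (f[τ]≤μ i)

    μ≤U : μ ≤ U
    μ≤U = ≤-trans (monotone best τ≤T) (≤-trans (f[T]≤m̂U best) (≤-max m̂U best))

    secondPhase : ℤ → Rand ℝ
    secondPhase j = randomRoundRobin I (L * 2^ j) τ N S >>= λ r →
      return (sum (λ i → cumulative I i N) + r)

    -- The expected total reward with the divisions of `T` already evaluated; it is identified with
    -- that of `algorithm` at the very end.
    𝔼-algorithm : ℝ
    𝔼-algorithm = 𝔼
      (uniform[ ℤ.- ⌈ log₂ (fromℕ T / fromℕ τ) ⌉ , ⌈ log₂ (U / L) ⌉ ] >>= secondPhase)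

    firstPhase : ℝ
    firstPhase = sum λ i → cumulative I i N

    0≤firstPhase : 0# ≤ firstPhase
    0≤firstPhase = 0≤sum {g = λ i → cumulative I i N} λ i →
      0≤sum {n = N} λ t → nonneg i (suc (toℕ t))

    ≤-secondPhase : ∀ j → 𝔼 (randomRoundRobin I (L * 2^ j) τ N S) ≤ 𝔼 (secondPhase j)
    ≤-secondPhase j = ≤-trans
      (≤-from 0≤firstPhase (solve 2 (λ e a → e :+ a := a :+ e) refl _ firstPhase))
      (𝔼-shift firstPhase (randomRoundRobin I (L * 2^ j) τ N S))

    0≤secondPhase : ∀ j → 0# ≤ 𝔼 (secondPhase j)
    0≤secondPhase j = ≤-trans (RoundRobinAnalysis.0≤𝔼-run I (L * 2^ j) τ N (allFin k) S)
      (≤-secondPhase j)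

    0≤𝔼-algorithm : 0# ≤ 𝔼-algorithm
    0≤𝔼-algorithm = 0≤𝔼>>=
      uniform[ ℤ.- ⌈ log₂ (fromℕ T / fromℕ τ) ⌉ , ⌈ log₂ (U / L) ⌉ ] secondPhase 0≤secondPhase

    q : ℕ
    q = proj₁ (√-scale 2≤k)

    1≤q : 1 ℕ.≤ q
    1≤q = proj₁ (proj₂ (√-scale 2≤k))

    q²≤k : q ℕ.* q ℕ.≤ k
    q²≤k = proj₁ (proj₂ (proj₂ (√-scale 2≤k)))

    k≤4q² : k ℕ.≤ 4 ℕ.* (q ℕ.* q)
    k≤4q² = proj₁ (proj₂ (proj₂ (proj₂ (√-scale 2≤k))))

    2q≤k : 2 ℕ.* q ℕ.≤ k
    2q≤k = proj₂ (proj₂ (proj₂ (proj₂ (√-scale 2≤k))))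

    q≤k : q ℕ.≤ k
    q≤k = ℕ.≤-trans (ℕ.m≤m+n q (q ℕ.+ 0)) 2q≤k

    6q≤S : 6 ℕ.* q ℕ.≤ S
    6q≤S = ℕ.≤-trans (ℕ.≤-reflexive (ℕ.*-assoc 3 2 q)) (ℕ.*-mono-≤ (ℕ.s≤s 2≤n) 2q≤k)

    log-k : ∃ λ l → 2# ^ suc l ≤ fromℕ k × fromℕ k ≤ 2# ^ suc (suc l)
    log-k = dyadic k (fromℕ-mono 2≤k) (fromℕ≤2^ k)

    -- An integer stand-in for `log₂ k`, at least 1 because `k ≥ 2`.
    ℓ : ℕ
    ℓ = suc (proj₁ log-k)

    2^ℓ≤k : 2# ^ ℓ ≤ fromℕ k
    2^ℓ≤k = proj₁ (proj₂ log-k)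

    k≤2^[1+ℓ] : fromℕ k ≤ 2# ^ suc ℓ
    k≤2^[1+ℓ] = proj₂ (proj₂ log-k)

    ℓ≤log₂k : fromℕ ℓ ≤ log₂ (fromℕ k)
    ℓ≤log₂k = proj₁ (log₂-bounds ℓ (suc ℓ) 2^ℓ≤k k≤2^[1+ℓ])

    qℓ≤D : fromℕ q * fromℕ ℓ ≤ √ (fromℕ k) * log₂ (fromℕ k)
    qℓ≤D = *-mono-≤ (0≤fromℕ q) (≤-trans (0≤fromℕ ℓ) ℓ≤log₂k) (fromℕ≤√ {q} 0<k q²≤k) ℓ≤log₂k

    0≤D : 0# ≤ √ (fromℕ k) * log₂ (fromℕ k)
    0≤D = ≤-trans (0≤fromℕ q ⊗ 0≤fromℕ ℓ) qℓ≤D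

    0<D : 0# < √ (fromℕ k) * log₂ (fromℕ k)
    0<D = <-≤-trans (*-pos (0<fromℕ 1≤q) (0<fromℕ-suc (proj₁ log-k))) qℓ≤D

    -- Drawing a good threshold when some first-phase reward is positive.

    module Positive (0<M : 0# < M) where
      0<L : 0# < L
      0<L = *-pos 0<M (⁻¹-pos 0<2)

      2L≈M : 2# * L ≈ M
      2L≈M = *-cancel-/ 0<2 M

      2≤μ/L : 2# ≤ μ / L
      2≤μ/L = *-cancelˡ-≤ 0<L (≤-respʳ (sym (*-cancel-/ 0<L μ))
        (≤-respˡ (trans (sym 2L≈M) (*-comm 2# L)) M≤μ))

      μ/L≤U/L : μ / L ≤ U / L
      μ/L≤U/L = /-mono 0<L μ≤U

      U/L≤2^[3+ℓ] : U / L ≤ 2# ^ suc (suc (suc ℓ))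
      U/L≤2^[3+ℓ] = *-cancelˡ-≤ 0<L (≤-respˡ (sym (*-cancel-/ 0<L U))
        (≤-trans (≤-respʳ (*-congˡ (sym 2L≈M)) U≤2kM)
          (≤-from (0≤fromℕ 4 ⊗ proj₁ 0<L ⊗ Δ k≤2^[1+ℓ])
            (solve 3 (λ k l x →
                con (+ 2) :* k :* (con (+ 2) :* l) :+ con (+ 4) :* l :* (x :- k)
                := l :* (con (+ 2) :* (con (+ 2) :* x)))
              refl (fromℕ k) L (2# ^ suc ℓ)))))

      -- `μ / L` lies between 2 and `4 k ≤ 2^(ℓ + 3)`. Rounding it down to `2^j` puts the threshold
      -- `L * 2^j` into `[μ/2, μ]`.
      scale : ∃ λ j → 2# ^ suc j ≤ μ / L × μ / L ≤ 2# ^ suc (suc j)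
      scale = dyadic (suc (suc (suc ℓ))) 2≤μ/L (≤-trans μ/L≤U/L U/L≤2^[3+ℓ])

      j : ℕ
      j = suc (proj₁ scale)

      m : ℝ
      m = L * 2# ^ j

      m≤μ : m ≤ μ
      m≤μ = ≤-respʳ (*-cancel-/ 0<L μ) (*-monoˡ-≤ (proj₁ 0<L) (proj₁ (proj₂ scale)))

      μ≤2m : μ ≤ 2# * m
      μ≤2m = ≤-respʳ
        (solve 2 (λ l x → l :* (con (+ 2) :* x) := con (+ 2) :* (l :* x)) refl L (2# ^ j))
        (≤-respˡ (*-cancel-/ 0<L μ) (*-monoˡ-≤ (proj₁ 0<L) (proj₂ (proj₂ scale))))

      hi-bounds : ∃ λ h → ⌈ log₂ (U / L) ⌉ ≡ + h × j ℕ.≤ h × h ℕ.≤ suc (suc (suc ℓ))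
      hi-bounds = ⌈log₂⌉-bounds j (suc (suc (suc ℓ)))
        (≤-trans (proj₁ (proj₂ scale)) μ/L≤U/L) U/L≤2^[3+ℓ]

      lo-bounds : ∃ λ c → ⌈ log₂ (fromℕ T / fromℕ τ) ⌉ ≡ + c × 0 ℕ.≤ c × c ℕ.≤ 2
      lo-bounds = ⌈log₂⌉-bounds 0 2
        (*-cancelˡ-≤ 0<fromℕ-τ (≤-respʳ (sym (*-cancel-/ 0<fromℕ-τ _))
          (≤-respˡ (sym (*-identityʳ _)) (fromℕ-mono τ≤T))))
        (*-cancelˡ-≤ 0<fromℕ-τ (≤-respˡ (sym (*-cancel-/ 0<fromℕ-τ _))
          (≤-trans (≤-respʳ (fromℕ-* 3 τ) (fromℕ-mono T≤3τ))
            (≤-from (0≤fromℕ τ)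
              (solve 1 (λ t → con (+ 3) :* t :+ t :=
                t :* (con (+ 2) :* (con (+ 2) :* con (+ 1)))) refl (fromℕ τ))))))

      -- At most `(ℓ + 3) + 2 + 1 = ℓ + 6` values of `j` are possible, and `ℓ ≥ 1`.
      choices≤7ℓ : suc (proj₁ hi-bounds ℕ.+ proj₁ lo-bounds) ℕ.≤ 7 ℕ.* ℓ
      choices≤7ℓ = ℕ.≤-trans
        (ℕ.s≤s (ℕ.+-mono-≤ (proj₂ (proj₂ (proj₂ hi-bounds))) (proj₂ (proj₂ (proj₂ lo-bounds)))))
        (ℕ.≤-trans (ℕ.≤-reflexive (≡.trans (≡.sym (ℕ.+-suc (3 ℕ.+ ℓ) 2)) (ℕ.+-comm (3 ℕ.+ ℓ) 3)))
          (ℕ.≤-trans (ℕ.≤-reflexive (ℕ.+-comm 6 ℓ))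
            (ℕ.+-monoʳ-≤ ℓ (ℕ.*-monoʳ-≤ 6 (ℕ.s≤s ℕ.z≤n)))))

      𝔼₂≤7ℓ𝔼 : 𝔼 (randomRoundRobin I m τ N S) ≤ fromℕ 7 * fromℕ ℓ * 𝔼-algorithm
      𝔼₂≤7ℓ𝔼 = ≤-trans (≤-secondPhase (+ j)) (≤-trans
        (𝔼-uniform-≥ (proj₁ lo-bounds) (proj₁ hi-bounds) j secondPhase
          (≡.cong ℤ.-_ (proj₁ (proj₂ lo-bounds))) (proj₁ (proj₂ hi-bounds))
          (proj₁ (proj₂ (proj₂ hi-bounds))) 0≤secondPhase)
        (*-mono-≤ (0≤fromℕ (suc (proj₁ hi-bounds ℕ.+ proj₁ lo-bounds))) 0≤𝔼-algorithm
          (≤-respʳ (fromℕ-* 7 ℓ) (fromℕ-mono choices≤7ℓ)) ≤-refl))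

      OPT≤ : OPT I T ≤ C * (fromℕ q * fromℕ ℓ) * 𝔼-algorithm
      OPT≤ = C-chain (0≤fromℕ S) (0≤fromℕ q) OPT≤6Sμ μ≤2m
        (𝔼-randomRoundRobin-≥ N best
          (proj₁ 0<L ⊗ 0≤2^ j) m≤μ 1≤τ τ≤S S≤2τ 1≤q 6q≤S q≤k k≤4q²)
        𝔼₂≤7ℓ𝔼

    OPT≤ : OPT I T ≤ C * (√ (fromℕ k) * log₂ (fromℕ k)) * 𝔼-algorithm
    OPT≤ with M ≤? 0#
    ... | no M≰0  = ≤-trans (Positive.OPT≤ (≰⇒> M≰0))
      (*-mono-≤ (0≤C ⊗ (0≤fromℕ q ⊗ 0≤fromℕ ℓ)) 0≤𝔼-algorithm
        (*-monoˡ-≤ 0≤C qℓ≤D) ≤-refl)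
    -- Here `μ ≤ U ≤ 2 k M ≤ 0`, so `OPT` is at most 0 and no draw needs analysis.
    ... | yes M≤0 = ≤-trans OPT≤6Sμ (≤-trans
      (≤-respʳ (zeroʳ _) (*-monoˡ-≤ (0≤fromℕ 6 ⊗ 0≤fromℕ S) (≤-trans μ≤U (≤-trans U≤2kM
        (≤-respʳ (zeroʳ _) (*-monoˡ-≤ (0≤fromℕ 2 ⊗ 0≤fromℕ k) M≤0))))))
      (0≤C ⊗ 0≤D ⊗ 0≤𝔼-algorithm))

theorem3p4p3 : (ℛ : Reals) (let open Reals ℛ) (let open Bandits ℛ) →
    ∃ λ (c : ℝ) → 0# < c ×
    (∀ (k T : ℕ) .{{_ : NonZero k}} (I : Instance k) →
    2 ℕ.≤ k → 4 ℕ.* k ℕ.< T → 2 ℕ.* k ∣ T →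
    c * (OPT I T / (√ (fromℕ k) * log₂ (fromℕ k))) ≤ 𝔼 (algorithm I T))
theorem3p4p3 ℛ = C ⁻¹ , ⁻¹-pos 0<C , bound
  where
  open OrderedField ℛ
  open Bandits ℛ
  open Analysis ℛ

  bound : ∀ (k T : ℕ) .{{_ : NonZero k}} (I : Instance k) →
    2 ℕ.≤ k → 4 ℕ.* k ℕ.< T → 2 ℕ.* k ∣ T →
    C ⁻¹ * (OPT I T / (√ (fromℕ k) * log₂ (fromℕ k))) ≤ 𝔼 (algorithm I T)
  bound k _ I 2≤k 4k<T (divides (suc n) ≡.refl) =
    /-≤ 0<C 0<D (≤-respʳ (*-congˡ (reflexive 𝔼≡)) OPT≤)
    where
    2≤n : 2 ℕ.≤ n
    2≤n = ℕ.s≤s⁻¹ (ℕ.*-cancelʳ-< (2 ℕ.* k) 2 (suc n)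
      (≡.subst (ℕ._< suc n ℕ.* (2 ℕ.* k)) (ℕ.*-assoc 2 2 k) 4k<T))

    open Main I 2≤k n 2≤n

    T/2≡S : T ℕ./ 2 ≡ S
    T/2≡S = ≡.trans (≡.cong (ℕ._/ 2) (≡.trans T≡2S (ℕ.*-comm 2 S))) (ℕ.m*n/n≡m S 2)

    -- Abstracting the expectation over the three numbers lets the equations for `T / (2k)`, `T / 2`
    -- and `T / 2 - k` be applied by congruence. At `suc n`, `τ` and `S` it unfolds to
    -- `𝔼-algorithm`.
    𝔼-with : ℕ → ℕ → ℕ → ℝ
    𝔼-with N τ S = 𝔼 (
      (uniform[ ℤ.- ⌈ log₂ (fromℕ T / fromℕ τ) ⌉ ,
        ⌈ log₂ (max (λ i → f i N + (f i N - f i (N ℕ.∸ 1)) * fromℕ (T ℕ.∸ N)) /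
          (max (λ i → f i N) / 2#)) ⌉ ]) >>= λ j →
      randomRoundRobin I (max (λ i → f i N) / 2# * 2^ j) τ N S >>= λ r →
      return (sum (λ i → cumulative I i N) + r))
      where open Instance I

    𝔼≡ : 𝔼-algorithm ≡ 𝔼 (algorithm I T)
    𝔼≡ = ≡.trans
      (≡.cong₂ (λ N S → 𝔼-with N τ S)
        (≡.sym (ℕ.m*n/n≡m (suc n) (2 ℕ.* k) {{ℕ.m*n≢0 2 k}})) (≡.sym T/2≡S))
      (≡.cong (λ τ → 𝔼-with (initialPulls I T) τ (T ℕ./ 2))
        (≡.trans (≡.sym (ℕ.m+n∸m≡n k τ)) (≡.cong (ℕ._∸ k) (≡.sym T/2≡S))))
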